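{- Let $k\geq 2$ be an integer and let $\epsilon\in\left(0,\frac1k\right)$ be a real number. Every $n$-vertex digraph $G$ with minimum outdegree at least $$2\epsilon^{ -2}\left(\frac{4}{k}-\epsilon\right)\log\left(\frac{2}{\epsilon k}-1\right)$$ contains a set $T$ of at least $\left(\frac1k-\epsilon\right)n$ vertices such that, for every vertex $v\in T$, at most $\frac1k\deg^+(v)$ out-neighbours of $v$ are also in $T$.
   Context: Digraphs are finite, with no loops and no parallel arcs (a pair of oppositely directed arcs $uv$ and $vu$ is allowed). $\log$ denotes the natural logarithm, and $\deg^+(v)$ denotes the outdegree of $v$ in $G$. -}

module Defs where

open import Data.Bool.Base using (Bool; false)
open import Data.Fin.Base using (Fin)
open import Data.Fin.Subset using (Subset; ∣_∣)
open import Data.Integer.Base using (+_)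
open import Data.Nat.Base as ℕ using (ℕ; zero; suc; _!)
open import Data.Nat.Properties as ℕₚ using (_!≢0)
open import Data.Product.Base using (∃-syntax; _×_; _,_)
open import Data.Rational.Base as ℚ using (ℚ; 0ℚ; 1ℚ; ½)
open import Data.Rational.Properties as ℚₚ
open import Data.Rational.Solver using (module +-*-Solver)
open import Data.Vec.Base using (tabulate)
open import Relation.Binary.PropositionalEquality using (_≡_; refl; sym; trans; cong; cong₂; subst)
open import Relation.Nullary using (¬_; yes; no; contradiction)

-- Digraphs on the vertex set Fin n: an arc is an ordered pair of vertices,
-- so parallel arcs cannot occur and opposite arcs can.

record Digraph (n : ℕ) : Set where
  field
    arc      : Fin n → Fin n → Bool
    loopless : ∀ v → arc v v ≡ false

  N⁺ : Fin n → Subset n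
  N⁺ v = tabulate (arc v)

  deg⁺ : Fin n → ℕ
  deg⁺ v = ∣ N⁺ v ∣

-- Reals are represented by Cauchy sequences of rationals; two sequences
-- represent the same real iff each is ≤ the other in the order below.

IsCauchy : (ℕ → ℚ) → Set
IsCauchy s = ∀ δ → 0ℚ ℚ.< δ →
  ∃[ N ] (∀ m n → N ℕ.≤ m → N ℕ.≤ n → ℚ.∣ s m ℚ.- s n ∣ ℚ.≤ δ)

-- Without eta, instance search for Positive does not unfold the sequences.
record ℝ : Set where
  no-eta-equality
  field
    seq    : ℕ → ℚ
    cauchy : IsCauchy seq

open ℝ public

record Positive (x : ℝ) : Set where
  constructor mkPositive
  field
    gap   : ℚ
    0<gap : 0ℚ ℚ.< gap
    from  : ℕ
    above : ∀ n → from ℕ.≤ n → gap ℚ.≤ seq x n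

private
  module S = +-*-Solver

  weaken₁ : ∀ {a b c} → a ℕ.⊔ b ℕ.≤ c → a ℕ.≤ c
  weaken₁ {a} {b} = ℕₚ.≤-trans (ℕₚ.m≤m⊔n a b)

  weaken₂ : ∀ {a b c} → a ℕ.⊔ b ℕ.≤ c → b ℕ.≤ c
  weaken₂ {a} {b} = ℕₚ.≤-trans (ℕₚ.m≤n⊔m a b)

  *-pos : ∀ {p q} → 0ℚ ℚ.< p → 0ℚ ℚ.< q → 0ℚ ℚ.< p ℚ.* q
  *-pos {p} {q} 0<p 0<q =
    positive⁻¹ (p ℚ.* q) {{pos*pos⇒pos p {{ℚ.positive 0<p}} q {{ℚ.positive 0<q}}}}

  *-mono-≤ : ∀ {p q r s} → 0ℚ ℚ.≤ p → 0ℚ ℚ.≤ s → p ℚ.≤ q → r ℚ.≤ s → p ℚ.* r ℚ.≤ q ℚ.* s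
  *-mono-≤ {p} {q} {r} {s} 0≤p 0≤s p≤q r≤s = ≤-trans
    (*-monoˡ-≤-nonNeg p {{ℚ.nonNegative 0≤p}} r≤s)
    (*-monoʳ-≤-nonNeg s {{ℚ.nonNegative 0≤s}} p≤q)

  module Inv {p} (0<p : 0ℚ ℚ.< p) where
    instance
      posp : ℚ.Positive p
      posp = ℚ.positive 0<p
      nzp : ℚ.NonZero p
      nzp = pos⇒nonZero p
    inv : ℚ
    inv = ℚ.1/ p
    0<inv : 0ℚ ℚ.< inv
    0<inv = positive⁻¹ inv {{1/pos⇒pos p}}
    p*inv : p ℚ.* inv ≡ 1ℚ
    p*inv = *-inverseʳ p

fromℚ : ℚ → ℝ
fromℚ q .seq _ = q
fromℚ q .cauchy δ 0<δ = 0 , λ _ _ _ _ →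
  ≤-trans (≤-reflexive (cong ℚ.∣_∣ (+-inverseʳ q))) (<⇒≤ 0<δ)

fromℕ : ℕ → ℝ
fromℕ n .seq    = fromℚ (+ n ℚ./ 1) .seq
fromℕ n .cauchy = fromℚ (+ n ℚ./ 1) .cauchy

infixl 6 _+_ _-_
infixl 7 _*_ _/_
infixr 8 _^_
infix  8 -_

_+_ : ℝ → ℝ → ℝ
(x + y) .seq n = seq x n ℚ.+ seq y n
(x + y) .cauchy δ 0<δ =
  let 0<δ/2      = *-pos (positive⁻¹ ½) 0<δ
      (M , xM)   = cauchy x (½ ℚ.* δ) 0<δ/2
      (N , yN)   = cauchy y (½ ℚ.* δ) 0<δ/2
  in M ℕ.⊔ N , λ m n p q →
    let a = seq x m ; b = seq x n ; c = seq y m ; d = seq y n in begin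
    ℚ.∣ (a ℚ.+ c) ℚ.- (b ℚ.+ d) ∣         ≡⟨ cong ℚ.∣_∣ (S.solve 4 (λ a b c d →
                                               (a S.:+ c) S.:- (b S.:+ d) S.:= (a S.:- b) S.:+ (c S.:- d)) refl a b c d) ⟩
    ℚ.∣ (a ℚ.- b) ℚ.+ (c ℚ.- d) ∣         ≤⟨ ∣p+q∣≤∣p∣+∣q∣ (a ℚ.- b) (c ℚ.- d) ⟩
    ℚ.∣ a ℚ.- b ∣ ℚ.+ ℚ.∣ c ℚ.- d ∣       ≤⟨ +-mono-≤ (xM m n (weaken₁ p) (weaken₁ q)) (yN m n (weaken₂ {M} p) (weaken₂ {M} q)) ⟩
    ½ ℚ.* δ ℚ.+ ½ ℚ.* δ                   ≡⟨ sym (*-distribʳ-+ δ ½ ½) ⟩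
    1ℚ ℚ.* δ                              ≡⟨ *-identityˡ δ ⟩
    δ                                     ∎
  where open ℚₚ.≤-Reasoning

-_ : ℝ → ℝ
(- x) .seq n = ℚ.- seq x n
(- x) .cauchy δ 0<δ =
  let (N , xN) = cauchy x δ 0<δ in N , λ m n p q →
    let a = seq x m ; b = seq x n in
    ≤-trans (≤-reflexive (trans
      (cong ℚ.∣_∣ (S.solve 2 (λ a b → (S.:- a) S.:- (S.:- b) S.:= S.:- (a S.:- b)) refl a b))
      (∣-p∣≡∣p∣ (a ℚ.- b)))) (xN m n p q)

_-_ : ℝ → ℝ → ℝ
x - y = x + - y

private
  -- A bound on ∣ seq x n ∣ valid from some index on.
  bounded : (x : ℝ) → ∃[ B ] (0ℚ ℚ.< B × ∃[ N ] (∀ n → N ℕ.≤ n → ℚ.∣ seq x n ∣ ℚ.≤ B))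
  bounded x =
    let (N , xN) = cauchy x 1ℚ (positive⁻¹ 1ℚ)
        b        = seq x N
    in 1ℚ ℚ.+ ℚ.∣ b ∣
     , +-mono-<-≤ (positive⁻¹ 1ℚ) (0≤∣p∣ b)
     , N , λ n p → let a = seq x n in begin
         ℚ.∣ a ∣                        ≡⟨ cong ℚ.∣_∣ (S.solve 2 (λ a b → a S.:= (a S.:- b) S.:+ b) refl a b) ⟩
         ℚ.∣ (a ℚ.- b) ℚ.+ b ∣          ≤⟨ ∣p+q∣≤∣p∣+∣q∣ (a ℚ.- b) b ⟩
         ℚ.∣ a ℚ.- b ∣ ℚ.+ ℚ.∣ b ∣      ≤⟨ +-monoˡ-≤ ℚ.∣ b ∣ (xN n N p ℕₚ.≤-refl) ⟩
         1ℚ ℚ.+ ℚ.∣ b ∣                 ∎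
    where open ℚₚ.≤-Reasoning

_*_ : ℝ → ℝ → ℝ
(x * y) .seq n = seq x n ℚ.* seq y n
(x * y) .cauchy δ 0<δ =
  let (B , 0<B , N₁ , xB) = bounded x
      (C , 0<C , N₂ , yC) = bounded y
      0<B+C               = +-mono-< 0<B 0<C
      open Inv 0<B+C
      η                   = δ ℚ.* inv
      0<η                 = *-pos 0<δ 0<inv
      (N₃ , xη)           = cauchy x η 0<η
      (N₄ , yη)           = cauchy y η 0<η
  in (N₁ ℕ.⊔ N₂) ℕ.⊔ (N₃ ℕ.⊔ N₄) , λ m n p q →
    let a = seq x m ; b = seq x n ; c = seq y m ; d = seq y n
        a≤B = xB m (weaken₁ {N₁} (weaken₁ p))
        d≤C = yC n (weaken₂ {N₁} (weaken₁ q))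
        ab  = xη m n (weaken₁ {N₃} (weaken₂ {N₁ ℕ.⊔ N₂} p)) (weaken₁ {N₃} (weaken₂ {N₁ ℕ.⊔ N₂} q))
        cd  = yη m n (weaken₂ {N₃} (weaken₂ {N₁ ℕ.⊔ N₂} p)) (weaken₂ {N₃} (weaken₂ {N₁ ℕ.⊔ N₂} q))
    in begin
    ℚ.∣ a ℚ.* c ℚ.- b ℚ.* d ∣                                ≡⟨ cong ℚ.∣_∣ (S.solve 4 (λ a b c d →
         a S.:* c S.:- b S.:* d S.:= a S.:* (c S.:- d) S.:+ d S.:* (a S.:- b)) refl a b c d) ⟩
    ℚ.∣ a ℚ.* (c ℚ.- d) ℚ.+ d ℚ.* (a ℚ.- b) ∣                ≤⟨ ∣p+q∣≤∣p∣+∣q∣ (a ℚ.* (c ℚ.- d)) (d ℚ.* (a ℚ.- b)) ⟩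
    ℚ.∣ a ℚ.* (c ℚ.- d) ∣ ℚ.+ ℚ.∣ d ℚ.* (a ℚ.- b) ∣          ≡⟨ cong₂ ℚ._+_ (∣p*q∣≡∣p∣*∣q∣ a (c ℚ.- d)) (∣p*q∣≡∣p∣*∣q∣ d (a ℚ.- b)) ⟩
    ℚ.∣ a ∣ ℚ.* ℚ.∣ c ℚ.- d ∣ ℚ.+ ℚ.∣ d ∣ ℚ.* ℚ.∣ a ℚ.- b ∣  ≤⟨ +-mono-≤
         (*-mono-≤ (0≤∣p∣ a) (<⇒≤ 0<η) a≤B cd) (*-mono-≤ (0≤∣p∣ d) (<⇒≤ 0<η) d≤C ab) ⟩
    B ℚ.* η ℚ.+ C ℚ.* η                                      ≡⟨ S.solve 4 (λ B C δ i →
         B S.:* (δ S.:* i) S.:+ C S.:* (δ S.:* i) S.:= ((B S.:+ C) S.:* i) S.:* δ) refl B C δ inv ⟩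
    ((B ℚ.+ C) ℚ.* inv) ℚ.* δ                                ≡⟨ cong (ℚ._* δ) p*inv ⟩
    1ℚ ℚ.* δ                                                 ≡⟨ *-identityˡ δ ⟩
    δ                                                        ∎
  where open ℚₚ.≤-Reasoning

_^_ : ℝ → ℕ → ℝ
x ^ zero  = fromℕ 1
x ^ suc n = x * x ^ n

-- The reciprocal with junk value 0 at 0; by positivity only finitely many
-- terms of the sequence of x ⁻¹ are junk.
recip : ℚ → ℚ
recip q with q ≟ 0ℚ
... | yes _   = 0ℚ
... | no  q≢0 = ℚ.1/_ q {{ℚ.≢-nonZero q≢0}}

private
  *-recip : ∀ {q} → 0ℚ ℚ.< q → q ℚ.* recip q ≡ 1ℚ
  *-recip {q} 0<q with q ≟ 0ℚ
  ... | yes q≡0 = contradiction (sym q≡0) (<⇒≢ 0<q)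
  ... | no  q≢0 = *-inverseʳ q {{ℚ.≢-nonZero q≢0}}

  -- 0 < g ≤ q  implies  ∣ 1/q ∣ ≤ 1/g
  ∣recip∣≤ : ∀ {g q} (0<g : 0ℚ ℚ.< g) → g ℚ.≤ q → ℚ.∣ recip q ∣ ℚ.≤ Inv.inv 0<g
  ∣recip∣≤ {g} {q} 0<g g≤q = begin
    ℚ.∣ r ∣                        ≡⟨ sym (*-identityˡ ℚ.∣ r ∣) ⟩
    1ℚ ℚ.* ℚ.∣ r ∣                 ≡⟨ cong (ℚ._* ℚ.∣ r ∣) (trans (sym p*inv) (*-comm g inv)) ⟩
    (inv ℚ.* g) ℚ.* ℚ.∣ r ∣        ≤⟨ *-monoʳ-≤-nonNeg ℚ.∣ r ∣ {{∣-∣-nonNeg r}} (*-monoˡ-≤-nonNeg inv {{ℚ.nonNegative (<⇒≤ 0<inv)}} g≤q) ⟩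
    (inv ℚ.* q) ℚ.* ℚ.∣ r ∣        ≡⟨ *-assoc inv q ℚ.∣ r ∣ ⟩
    inv ℚ.* (q ℚ.* ℚ.∣ r ∣)        ≡⟨ cong (λ t → inv ℚ.* (t ℚ.* ℚ.∣ r ∣)) (sym (0≤p⇒∣p∣≡p (<⇒≤ 0<q))) ⟩
    inv ℚ.* (ℚ.∣ q ∣ ℚ.* ℚ.∣ r ∣)  ≡⟨ cong (inv ℚ.*_) (sym (∣p*q∣≡∣p∣*∣q∣ q r)) ⟩
    inv ℚ.* ℚ.∣ q ℚ.* r ∣          ≡⟨ cong (λ t → inv ℚ.* ℚ.∣ t ∣) (*-recip 0<q) ⟩
    inv ℚ.* 1ℚ                     ≡⟨ *-identityʳ inv ⟩
    inv                            ∎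
    where
      open ℚₚ.≤-Reasoning
      open Inv 0<g
      r = recip q
      0<q : 0ℚ ℚ.< q
      0<q = <-≤-trans 0<g g≤q

_⁻¹ : (x : ℝ) {{_ : Positive x}} → ℝ
(x ⁻¹) .seq n = recip (seq x n)
_⁻¹ x {{mkPositive g 0<g N₁ g≤x}} .cauchy δ 0<δ =
  let open Inv 0<g
      η        = δ ℚ.* (g ℚ.* g)
      0<η      = *-pos 0<δ (*-pos 0<g 0<g)
      (N₂ , xη) = cauchy x η 0<η
  in N₁ ℕ.⊔ N₂ , λ m n p q →
    let a = seq x m ; b = seq x n ; r = recip a ; s = recip b
        g≤a = g≤x m (weaken₁ p)
        g≤b = g≤x n (weaken₁ q)
        ar  = *-recip (<-≤-trans 0<g g≤a)
        bs  = *-recip (<-≤-trans 0<g g≤b)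
    in begin
    ℚ.∣ r ℚ.- s ∣                                  ≡⟨ cong ℚ.∣_∣ (sym (cong₂ ℚ._-_ (*-identityʳ r) (*-identityʳ s))) ⟩
    ℚ.∣ r ℚ.* 1ℚ ℚ.- s ℚ.* 1ℚ ∣                    ≡⟨ cong ℚ.∣_∣ (sym (cong₂ (λ t u → r ℚ.* t ℚ.- s ℚ.* u) bs ar)) ⟩
    ℚ.∣ r ℚ.* (b ℚ.* s) ℚ.- s ℚ.* (a ℚ.* r) ∣      ≡⟨ cong ℚ.∣_∣ (S.solve 4 (λ a b r s →
         r S.:* (b S.:* s) S.:- s S.:* (a S.:* r) S.:= S.:- ((r S.:* s) S.:* (a S.:- b))) refl a b r s) ⟩
    ℚ.∣ ℚ.- ((r ℚ.* s) ℚ.* (a ℚ.- b)) ∣            ≡⟨ ∣-p∣≡∣p∣ ((r ℚ.* s) ℚ.* (a ℚ.- b)) ⟩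
    ℚ.∣ (r ℚ.* s) ℚ.* (a ℚ.- b) ∣                  ≡⟨ ∣p*q∣≡∣p∣*∣q∣ (r ℚ.* s) (a ℚ.- b) ⟩
    ℚ.∣ r ℚ.* s ∣ ℚ.* ℚ.∣ a ℚ.- b ∣                ≡⟨ cong (ℚ._* ℚ.∣ a ℚ.- b ∣) (∣p*q∣≡∣p∣*∣q∣ r s) ⟩
    (ℚ.∣ r ∣ ℚ.* ℚ.∣ s ∣) ℚ.* ℚ.∣ a ℚ.- b ∣        ≤⟨ *-mono-≤
         (subst (0ℚ ℚ.≤_) (∣p*q∣≡∣p∣*∣q∣ r s) (0≤∣p∣ (r ℚ.* s))) (<⇒≤ 0<η)
         (*-mono-≤ (0≤∣p∣ r) (<⇒≤ 0<inv) (∣recip∣≤ 0<g g≤a) (∣recip∣≤ 0<g g≤b))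
         (xη m n (weaken₂ {N₁} p) (weaken₂ {N₁} q)) ⟩
    (inv ℚ.* inv) ℚ.* (δ ℚ.* (g ℚ.* g))            ≡⟨ S.solve 3 (λ i δ g →
         (i S.:* i) S.:* (δ S.:* (g S.:* g)) S.:= (g S.:* i) S.:* ((g S.:* i) S.:* δ)) refl inv δ g ⟩
    (g ℚ.* inv) ℚ.* ((g ℚ.* inv) ℚ.* δ)            ≡⟨ cong (λ t → t ℚ.* (t ℚ.* δ)) p*inv ⟩
    1ℚ ℚ.* (1ℚ ℚ.* δ)                              ≡⟨ trans (*-identityˡ _) (*-identityˡ δ) ⟩
    δ                                              ∎
  where open ℚₚ.≤-Reasoning

_/_ : (x y : ℝ) {{_ : Positive y}} → ℝ
x / y = x * y ⁻¹

instance
  fromℕ-positive : ∀ {n} .{{_ : ℕ.NonZero n}} → Positive (fromℕ n)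
  fromℕ-positive {n} =
    mkPositive _ (positive⁻¹ (+ n ℚ./ 1) {{normalize-pos n 1}}) 0 (λ _ _ → ≤-refl)

  *-positive : ∀ {x y} {{_ : Positive x}} {{_ : Positive y}} → Positive (x * y)
  *-positive {{mkPositive g 0<g M g≤}} {{mkPositive h 0<h N h≤}} =
    mkPositive (g ℚ.* h) (*-pos 0<g 0<h) (M ℕ.⊔ N) λ n p →
      let g≤xn = g≤ n (weaken₁ p) ; h≤yn = h≤ n (weaken₂ {M} p) in
      *-mono-≤ (<⇒≤ 0<g) (≤-trans (<⇒≤ 0<h) h≤yn) g≤xn h≤yn

infix 4 _<_ _≤_

_<_ : ℝ → ℝ → Set
x < y = Positive (y - x)

_≤_ : ℝ → ℝ → Set
x ≤ y = ¬ (y < x)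

infix 4 _⟶_

_⟶_ : (ℕ → ℝ) → ℝ → Set
s ⟶ x = ∀ δ → Positive δ → ∃[ N ] (∀ n → N ℕ.≤ n → (x - δ < s n) × (s n < x + δ))

expSum : ℝ → ℕ → ℝ
expSum y zero    = fromℕ 0
expSum y (suc n) = expSum y n + y ^ n * fromℚ (ℚ._/_ (+ 1) (n !) {{n !≢0}})

-- L = log x, as the inverse of exp y = ∑ yⁿ / n! : L is the real with exp L = x.
IsLog : (x L : ℝ) → Set
IsLog x L = expSum L ⟶ x

{-# OPTIONS --safe #-}

-- Choose a random vertex set S, taking each vertex with probability p = 1/k - ε/2, and discard every
-- v ∈ S with more than deg⁺(v)/k out-neighbours in S. As v is not its own out-neighbour, v survives
-- with probability p (1 - q), where Chernoff's inequality gives q ≤ exp (-ε² deg⁺(v) / (2 (4/k - ε))).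
-- The degree condition makes this at most 1/(2/(εk) - 1), so that p (1 - q) ≥ 1/k - ε.
--
-- The set T is a largest set of the required kind, found by exhaustive search. That it is large enough
-- is a negated statement, so a strictly positive defect may be assumed; it absorbs the error of
-- replacing ε and log by rational approximations, and the computation takes place in ℚ with the
-- partial sums of exp.

module Submission where

-- The constants come from one rational inequality. Put `z = kε/2` and tilt by `t = 1/(1-z)`, so
-- that `p t = 1/k` and a single out-neighbour has generating function `1 + ε/2`. With `d`
-- out-neighbours, a vertex is bad with probability at most `(1+ε/2)^d (1-z)^j`, where `j` is the
-- least integer above `d/k`. As `(1+ε/2)^k ≤ exp z`, a decay rate `w/k` per out-neighbour only
-- needs `exp (w+z) ≤ 1/(1-z)`. The bound `exp s ≤ (2+s)/(2-s)` supplies this for `w = z²/(2-z)`,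
-- and then `w/k = ε²/(2(4/k-ε))`. The argument of the logarithm is `(1-z)/z`, which makes the loss
-- `p q` at most `z/k = ε/2`.
--
-- Over the rationals there are only partial sums, and a product of partial sums is not a partial
-- sum; so the number of terms is tracked through every inequality, and `k`-th powers replace `k`-th
-- roots. A rational approximation of the logarithm may also be negative, which calls for a bound on
-- alternating partial sums.

module Proof where

  open import Algebra.Bundles using (module CommutativeRing)
  open import Data.Bool.Base using (Bool; true; false; _∧_)
  open import Data.Fin.Base using (Fin; zero; suc)
  open import Data.Fin.Properties using (all?)
  open import Data.Fin.Subset using (Subset; inside; outside; ∣_∣; _∩_; _∈_; _⊆_; ⊥)
  open import Data.Fin.Subset.Properties using (_∈?_; ∣p∣≤n; anySubset?; p⊆q⇒∣p∣≤∣q∣; x∈p∩q⁺; x∈p∩q⁻)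
  open import Data.Integer.Base as ℤ using (+_)
  import Data.Integer.Properties as ℤₚ
  open import Data.Nat.Base as ℕ using (ℕ; zero; suc; z≤n; s≤s; _!)
  import Data.Nat.DivMod as ℕ
  import Data.Nat.Properties as ℕₚ
  open import Data.Nat.Properties using (_!≢0)
  open import Data.Product.Base using (∃-syntax; _×_; _,_; proj₁; proj₂)
  open import Data.Rational.Base as ℚ hiding (∣_∣)
  open import Data.Rational.Properties
  import Data.Rational.Unnormalised.Base as ℚᵘ
  import Data.Rational.Unnormalised.Properties as ℚᵘₚ
  open import Data.Sum.Base using (inj₁; inj₂)
  open import Data.Vec.Base using ([]; _∷_; lookup; tabulate)
  open import Data.Vec.Properties using (lookup∘tabulate; []=⇒lookup; lookup⇒[]=)
  open import Function.Base using (_∘_)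
  open import Level using (0ℓ)
  open import Relation.Binary.PropositionalEquality
  open import Relation.Nullary using (¬_; Dec; yes; no; does; contradiction)
  open import Relation.Nullary.Decidable using (_×-dec_; _→-dec_; dec⇒maybe)
  open import Relation.Unary using (Decidable)
  open import Algebra.Properties.CommutativeSemiring.Exp (CommutativeRing.commutativeSemiring +-*-commutativeRing)
  import Tactic.RingSolver.Core.AlmostCommutativeRing as ACR
  open import Tactic.RingSolver using (solve-∀)
  open import Defs using (Digraph; ℝ; seq; cauchy; mkPositive; expSum; fromℕ; fromℚ; recip)

  ring : ACR.AlmostCommutativeRing 0ℓ 0ℓ
  ring = ACR.fromCommutativeRing +-*-commutativeRing (λ x → dec⇒maybe (0ℚ ≟ x))

  -- Ordered field arithmetic

  0≤1 : 0ℚ ≤ 1ℚ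
  0≤1 = nonNegative⁻¹ 1ℚ

  ½≤1 : ½ ≤ 1ℚ
  ½≤1 = *≤* (ℤ.+≤+ (s≤s z≤n))

  *-monoʳ : ∀ {r p q} → 0ℚ ≤ r → p ≤ q → r * p ≤ r * q
  *-monoʳ {r} 0≤r = *-monoˡ-≤-nonNeg r {{nonNegative 0≤r}}

  *-monoˡ : ∀ {r p q} → 0ℚ ≤ r → p ≤ q → p * r ≤ q * r
  *-monoˡ {r} 0≤r = *-monoʳ-≤-nonNeg r {{nonNegative 0≤r}}

  *-mono : ∀ {p q r s} → 0ℚ ≤ p → 0ℚ ≤ s → p ≤ q → r ≤ s → p * r ≤ q * s
  *-mono 0≤p 0≤s p≤q r≤s = ≤-trans (*-monoʳ 0≤p r≤s) (*-monoˡ 0≤s p≤q)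

  0≤+ : ∀ {p q} → 0ℚ ≤ p → 0ℚ ≤ q → 0ℚ ≤ p + q
  0≤+ = +-mono-≤

  0≤* : ∀ {p q} → 0ℚ ≤ p → 0ℚ ≤ q → 0ℚ ≤ p * q
  0≤* {p} 0≤p 0≤q = subst (_≤ p * _) (*-zeroʳ p) (*-monoʳ 0≤p 0≤q)

  0<* : ∀ {p q} → 0ℚ < p → 0ℚ < q → 0ℚ < p * q
  0<* {p} {q} 0<p 0<q = positive⁻¹ (p * q) {{pos*pos⇒pos p {{positive 0<p}} q {{positive 0<q}}}}

  p≤p+q : ∀ {p q} → 0ℚ ≤ q → p ≤ p + q
  p≤p+q {p} {q} 0≤q = subst (_≤ p + q) (+-identityʳ p) (+-monoʳ-≤ p 0≤q)

  p≤q⇒0≤q-p : ∀ {p q} → p ≤ q → 0ℚ ≤ q - p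
  p≤q⇒0≤q-p {p} {q} p≤q = subst (_≤ q - p) (+-inverseʳ p) (+-monoˡ-≤ (- p) p≤q)

  p<q⇒0<q-p : ∀ {p q} → p < q → 0ℚ < q - p
  p<q⇒0<q-p {p} {q} p<q = subst (_< q - p) (+-inverseʳ p) (+-monoˡ-< (- p) p<q)

  0≤q-p⇒p≤q : ∀ {p q} → 0ℚ ≤ q - p → p ≤ q
  0≤q-p⇒p≤q {p} {q} 0≤d = subst (p ≤_) (p+[q-p]≡q p q) (p≤p+q 0≤d)
    where
    p+[q-p]≡q : ∀ p q → p + (q - p) ≡ q
    p+[q-p]≡q = solve-∀ ring

  *-cancelˡ-≤ : ∀ {r p q} → 0ℚ < r → r * p ≤ r * q → p ≤ q
  *-cancelˡ-≤ {r} 0<r = *-cancelˡ-≤-pos r {{positive 0<r}}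

  recip-inverse : ∀ {q} → 0ℚ < q → q * recip q ≡ 1ℚ
  recip-inverse {q} 0<q with q ≟ 0ℚ
  ... | yes q≡0 = contradiction (sym q≡0) (<⇒≢ 0<q)
  ... | no  q≢0 = *-inverseʳ q {{≢-nonZero q≢0}}

  0<recip : ∀ {q} → 0ℚ < q → 0ℚ < recip q
  0<recip {q} 0<q with q ≟ 0ℚ
  ... | yes q≡0 = contradiction (sym q≡0) (<⇒≢ 0<q)
  ... | no  q≢0 = positive⁻¹ _ {{1/pos⇒pos q {{positive 0<q}}}}

  0≤^ : ∀ {p} → 0ℚ ≤ p → ∀ n → 0ℚ ≤ p ^ n
  0≤^ 0≤p zero    = 0≤1
  0≤^ 0≤p (suc n) = 0≤* 0≤p (0≤^ 0≤p n)

  ^-monoˡ : ∀ {p q} → 0ℚ ≤ p → p ≤ q → ∀ n → p ^ n ≤ q ^ n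
  ^-monoˡ 0≤p p≤q zero    = ≤-refl
  ^-monoˡ 0≤p p≤q (suc n) = *-mono 0≤p (0≤^ (≤-trans 0≤p p≤q) n) p≤q (^-monoˡ 0≤p p≤q n)

  1^n≡1 : ∀ n → 1ℚ ^ n ≡ 1ℚ
  1^n≡1 zero    = refl
  1^n≡1 (suc n) = trans (*-identityˡ (1ℚ ^ n)) (1^n≡1 n)

  p^n≤1 : ∀ {p} → 0ℚ ≤ p → p ≤ 1ℚ → ∀ n → p ^ n ≤ 1ℚ
  p^n≤1 0≤p p≤1 n = ≤-trans (^-monoˡ 0≤p p≤1 n) (≤-reflexive (1^n≡1 n))

  ^-antimonoʳ : ∀ {p m n} → 0ℚ ≤ p → p ≤ 1ℚ → m ℕ.≤ n → p ^ n ≤ p ^ m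
  ^-antimonoʳ {n = n} 0≤p p≤1 z≤n = p^n≤1 0≤p p≤1 n
  ^-antimonoʳ 0≤p p≤1 (s≤s m≤n)   = *-monoʳ 0≤p (^-antimonoʳ 0≤p p≤1 m≤n)

  1≤p^n : ∀ {p} → 1ℚ ≤ p → ∀ n → 1ℚ ≤ p ^ n
  1≤p^n 1≤p n = ≤-trans (≤-reflexive (sym (1^n≡1 n))) (^-monoˡ 0≤1 1≤p n)

  -- Stands in for an `n`-th root: if `p` exceeded `q`, it would be above 1 and hence at most its
  -- own power. This is weaker than comparing with the root of `q`, but `q` will be `1 + η`, so only
  -- an error term suffers.
  ^-cancel-≤ : ∀ {p q} n .{{_ : ℕ.NonZero n}} → 1ℚ ≤ q → p ^ n ≤ q → p ≤ q
  ^-cancel-≤ {p} {q} (suc n) 1≤q pⁿ≤q with p ≤? q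
  ... | yes p≤q = p≤q
  ... | no  p≰q = contradiction (<-≤-trans q<p (≤-trans p≤p^n pⁿ≤q)) (<-irrefl refl)
    where
    q<p = ≰⇒> p≰q
    1≤p = ≤-trans 1≤q (<⇒≤ q<p)
    p≤p^n : p ≤ p ^ suc n
    p≤p^n = ≤-trans (≤-reflexive (sym (*-identityʳ p))) (*-monoʳ (≤-trans 0≤1 1≤p) (1≤p^n 1≤p n))

  -- Natural numbers as rationals

  ⟦_⟧ : ℕ → ℚ
  ⟦ n ⟧ = + n / 1

  private
    fromℚᵘ-homo-+ : ∀ p q → fromℚᵘ p + fromℚᵘ q ≡ fromℚᵘ (p ℚᵘ.+ q)
    fromℚᵘ-homo-+ p q = toℚᵘ-injective (ℚᵘₚ.≃-trans (toℚᵘ-homo-+ (fromℚᵘ p) (fromℚᵘ q))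
      (ℚᵘₚ.≃-trans (ℚᵘₚ.+-cong (toℚᵘ-fromℚᵘ p) (toℚᵘ-fromℚᵘ q)) (ℚᵘₚ.≃-sym (toℚᵘ-fromℚᵘ (p ℚᵘ.+ q)))))

    fromℚᵘ-homo-* : ∀ p q → fromℚᵘ p * fromℚᵘ q ≡ fromℚᵘ (p ℚᵘ.* q)
    fromℚᵘ-homo-* p q = toℚᵘ-injective (ℚᵘₚ.≃-trans (toℚᵘ-homo-* (fromℚᵘ p) (fromℚᵘ q))
      (ℚᵘₚ.≃-trans (ℚᵘₚ.*-cong (toℚᵘ-fromℚᵘ p) (toℚᵘ-fromℚᵘ q)) (ℚᵘₚ.≃-sym (toℚᵘ-fromℚᵘ (p ℚᵘ.* q)))))

  ⟦⟧-homo-+ : ∀ m n → ⟦ m ℕ.+ n ⟧ ≡ ⟦ m ⟧ + ⟦ n ⟧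
  ⟦⟧-homo-+ m n = sym (trans (fromℚᵘ-homo-+ (ℚᵘ.mkℚᵘ (+ m) 0) (ℚᵘ.mkℚᵘ (+ n) 0))
    (cong (_/ 1) (cong₂ ℤ._+_ (ℤₚ.*-identityʳ (+ m)) (ℤₚ.*-identityʳ (+ n)))))

  ⟦⟧-homo-* : ∀ m n → ⟦ m ℕ.* n ⟧ ≡ ⟦ m ⟧ * ⟦ n ⟧
  ⟦⟧-homo-* m n = sym (trans (fromℚᵘ-homo-* (ℚᵘ.mkℚᵘ (+ m) 0) (ℚᵘ.mkℚᵘ (+ n) 0))
    (cong (_/ 1) (sym (ℤₚ.pos-* m n))))

  ⟦⟧-suc : ∀ n → ⟦ suc n ⟧ ≡ 1ℚ + ⟦ n ⟧
  ⟦⟧-suc = ⟦⟧-homo-+ 1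

  0≤⟦⟧ : ∀ n → 0ℚ ≤ ⟦ n ⟧
  0≤⟦⟧ n = nonNegative⁻¹ ⟦ n ⟧ {{normalize-nonNeg n 1}}

  0<⟦⟧ : ∀ n .{{_ : ℕ.NonZero n}} → 0ℚ < ⟦ n ⟧
  0<⟦⟧ n = positive⁻¹ ⟦ n ⟧ {{normalize-pos n 1}}

  ⟦⟧-mono : ∀ {m n} → m ℕ.≤ n → ⟦ m ⟧ ≤ ⟦ n ⟧
  ⟦⟧-mono {m} {n} m≤n = subst (⟦ m ⟧ ≤_)
    (trans (sym (⟦⟧-homo-+ m (n ℕ.∸ m))) (cong ⟦_⟧ (ℕₚ.m+[n∸m]≡n m≤n))) (p≤p+q (0≤⟦⟧ (n ℕ.∸ m)))

  ⟦n⟧*1/n≡1 : ∀ n .{{_ : ℕ.NonZero n}} → ⟦ n ⟧ * (+ 1 / n) ≡ 1ℚ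
  ⟦n⟧*1/n≡1 n@(suc n-1) = trans (fromℚᵘ-homo-* (ℚᵘ.mkℚᵘ (+ n) 0) (ℚᵘ.mkℚᵘ (+ 1) n-1))
    (fromℚᵘ-cong {ℚᵘ.mkℚᵘ (+ n) 0 ℚᵘ.* ℚᵘ.mkℚᵘ (+ 1) n-1} {ℚᵘ.1ℚᵘ} (ℚᵘ.*≡*
      (trans (ℤₚ.*-identityʳ (+ n ℤ.* + 1)) (trans (ℤₚ.*-comm (+ n) (+ 1)) (cong (λ i → + 1 ℤ.* + suc i) (sym (ℕₚ.+-identityʳ n-1)))))))

  -- Finite sums and the exponential series

  ∑ : ℕ → (ℕ → ℚ) → ℚ
  ∑ zero    f = 0ℚ
  ∑ (suc n) f = ∑ n f + f n

  ∑-cong : ∀ n {f g} → (∀ i → i ℕ.< n → f i ≡ g i) → ∑ n f ≡ ∑ n g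
  ∑-cong zero    f≡g = refl
  ∑-cong (suc n) f≡g = cong₂ _+_ (∑-cong n (λ i i<n → f≡g i (ℕₚ.m<n⇒m<1+n i<n))) (f≡g n ℕₚ.≤-refl)

  ∑-mono : ∀ n {f g} → (∀ i → i ℕ.< n → f i ≤ g i) → ∑ n f ≤ ∑ n g
  ∑-mono zero    f≤g = ≤-refl
  ∑-mono (suc n) f≤g = +-mono-≤ (∑-mono n (λ i i<n → f≤g i (ℕₚ.m<n⇒m<1+n i<n))) (f≤g n ℕₚ.≤-refl)

  ∑-distrib-+ : ∀ n f g → ∑ n (λ i → f i + g i) ≡ ∑ n f + ∑ n g
  ∑-distrib-+ zero    f g = refl
  ∑-distrib-+ (suc n) f g = trans (cong (_+ (f n + g n)) (∑-distrib-+ n f g))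
    (interchange (∑ n f) (∑ n g) (f n) (g n))
    where
    interchange : ∀ a b c d → (a + b) + (c + d) ≡ (a + c) + (b + d)
    interchange = solve-∀ ring

  *-distribˡ-∑ : ∀ n c f → ∑ n (λ i → c * f i) ≡ c * ∑ n f
  *-distribˡ-∑ zero    c f = sym (*-zeroʳ c)
  *-distribˡ-∑ (suc n) c f = trans (cong (_+ c * f n) (*-distribˡ-∑ n c f)) (sym (*-distribˡ-+ c (∑ n f) (f n)))

  *-distribʳ-∑ : ∀ n c f → ∑ n (λ i → f i * c) ≡ ∑ n f * c
  *-distribʳ-∑ n c f = trans (∑-cong n (λ i _ → *-comm (f i) c)) (trans (*-distribˡ-∑ n c f) (*-comm c (∑ n f)))

  ∑-head : ∀ n f → ∑ (suc n) f ≡ f 0 + ∑ n (f ∘ suc)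
  ∑-head zero    f = +-comm 0ℚ (f 0)
  ∑-head (suc n) f = trans (cong (_+ f (suc n)) (∑-head n f)) (+-assoc (f 0) (∑ n (f ∘ suc)) (f (suc n)))

  0≤∑ : ∀ n {f} → (∀ i → 0ℚ ≤ f i) → 0ℚ ≤ ∑ n f
  0≤∑ zero    0≤f = ≤-refl
  0≤∑ (suc n) 0≤f = 0≤+ (0≤∑ n 0≤f) (0≤f n)

  ∑-monoˡ : ∀ {m n f} → (∀ i → 0ℚ ≤ f i) → m ℕ.≤ n → ∑ m f ≤ ∑ n f
  ∑-monoˡ {n = n} 0≤f z≤n = 0≤∑ n 0≤f
  ∑-monoˡ {suc m} {suc n} {f} 0≤f (s≤s m≤n) = subst₂ _≤_ (sym (∑-head m f)) (sym (∑-head n f))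
    (+-monoʳ-≤ (f 0) (∑-monoˡ (0≤f ∘ suc) m≤n))

  inv! : ℕ → ℚ
  inv! n = _/_ (+ 1) (n !) {{n !≢0}}

  [1+n]/[1+n]! : ∀ n → ⟦ suc n ⟧ * inv! (suc n) ≡ inv! n
  [1+n]/[1+n]! n = begin
    ⟦ suc n ⟧ * g                   ≡⟨ *-identityʳ _ ⟨
    ⟦ suc n ⟧ * g * 1ℚ              ≡⟨ cong (⟦ suc n ⟧ * g *_) (⟦n⟧*1/n≡1 (n !) {{n !≢0}}) ⟨
    ⟦ suc n ⟧ * g * (⟦ n ! ⟧ * f)   ≡⟨ swap ⟦ suc n ⟧ g ⟦ n ! ⟧ f ⟩
    ⟦ suc n ⟧ * ⟦ n ! ⟧ * g * f     ≡⟨ cong (λ x → x * g * f) (⟦⟧-homo-* (suc n) (n !)) ⟨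
    ⟦ suc n ! ⟧ * g * f             ≡⟨ cong (_* f) (⟦n⟧*1/n≡1 (suc n !) {{suc n !≢0}}) ⟩
    1ℚ * f                          ≡⟨ *-identityˡ f ⟩
    f                               ∎
    where
    open ≡-Reasoning
    f = inv! n
    g = inv! (suc n)
    swap : ∀ a b c d → a * b * (c * d) ≡ a * c * b * d
    swap = solve-∀ ring

  expTerm : ℚ → ℕ → ℚ
  expTerm a n = a ^ n * inv! n

  exp< : ℕ → ℚ → ℚ
  exp< n a = ∑ n (expTerm a)

  expTerm-suc : ∀ a n → ⟦ suc n ⟧ * expTerm a (suc n) ≡ a * expTerm a n
  expTerm-suc a n = trans (shuffle ⟦ suc n ⟧ a (a ^ n) (inv! (suc n))) (cong (λ x → a * (a ^ n * x)) ([1+n]/[1+n]! n))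
    where
    shuffle : ∀ m a b c → m * (a * b * c) ≡ a * (b * (m * c))
    shuffle = solve-∀ ring

  0≤1/n! : ∀ n → 0ℚ ≤ inv! n
  0≤1/n! n = nonNegative⁻¹ _ {{normalize-nonNeg 1 (n !) {{n !≢0}}}}

  0≤expTerm : ∀ {a} → 0ℚ ≤ a → ∀ n → 0ℚ ≤ expTerm a n
  0≤expTerm 0≤a n = 0≤* (0≤^ 0≤a n) (0≤1/n! n)

  0≤exp : ∀ {a} → 0ℚ ≤ a → ∀ n → 0ℚ ≤ exp< n a
  0≤exp 0≤a n = 0≤∑ n (0≤expTerm 0≤a)

  exp-mono : ∀ {a b} → 0ℚ ≤ a → a ≤ b → ∀ n → exp< n a ≤ exp< n b
  exp-mono 0≤a a≤b n = ∑-mono n (λ i _ → *-monoˡ (0≤1/n! i) (^-monoˡ 0≤a a≤b i))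

  exp-monoˡ : ∀ {a m n} → 0ℚ ≤ a → m ℕ.≤ n → exp< m a ≤ exp< n a
  exp-monoˡ 0≤a = ∑-monoˡ (0≤expTerm 0≤a)

  -- The binomial theorem divided by `n !`. Both sides satisfy `(n+1) x(n+1) = (a+b) x(n)`: in the
  -- convolution the factor `n+1` splits as `i + (n+1-i)`, and `expTerm-suc` lowers the index of one
  -- factor in each half.
  expTerm-+ : ∀ a b n → ∑ (suc n) (λ i → expTerm a i * expTerm b (n ℕ.∸ i)) ≡ expTerm (a + b) n
  expTerm-+ a b zero    = refl
  expTerm-+ a b (suc n) = *-cancel (begin
    ⟦ suc n ⟧ * conv (suc n)
      ≡⟨ *-distribˡ-∑ (2 ℕ.+ n) ⟦ suc n ⟧ (term (suc n)) ⟨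
    ∑ (2 ℕ.+ n) (λ i → ⟦ suc n ⟧ * term (suc n) i)
      ≡⟨ ∑-cong (2 ℕ.+ n) (λ i i< → split i (ℕₚ.≤-pred i<)) ⟩
    ∑ (2 ℕ.+ n) (λ i → left i + right i)
      ≡⟨ ∑-distrib-+ (2 ℕ.+ n) left right ⟩
    ∑ (2 ℕ.+ n) left + ∑ (2 ℕ.+ n) right
      ≡⟨ cong₂ _+_ leftSum rightSum ⟩
    a * conv n + b * conv n
      ≡⟨ *-distribʳ-+ (conv n) a b ⟨
    (a + b) * conv n
      ≡⟨ cong ((a + b) *_) (expTerm-+ a b n) ⟩
    (a + b) * expTerm (a + b) n
      ≡⟨ expTerm-suc (a + b) n ⟨
    ⟦ suc n ⟧ * expTerm (a + b) (suc n) ∎)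
    where
    open ≡-Reasoning
    term : ℕ → ℕ → ℚ
    term n i = expTerm a i * expTerm b (n ℕ.∸ i)
    conv : ℕ → ℚ
    conv n = ∑ (suc n) (term n)
    left right : ℕ → ℚ
    left  i = ⟦ i ⟧ * expTerm a i * expTerm b (suc n ℕ.∸ i)
    right i = expTerm a i * (⟦ suc n ℕ.∸ i ⟧ * expTerm b (suc n ℕ.∸ i))
    *-cancel : ∀ {p q} → ⟦ suc n ⟧ * p ≡ ⟦ suc n ⟧ * q → p ≡ q
    *-cancel eq = ≤-antisym (*-cancelˡ-≤ (0<⟦⟧ (suc n)) (≤-reflexive eq)) (*-cancelˡ-≤ (0<⟦⟧ (suc n)) (≤-reflexive (sym eq)))
    regroup : ∀ s t x y → (s + t) * (x * y) ≡ s * x * y + x * (t * y)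
    regroup = solve-∀ ring
    split : ∀ i → i ℕ.≤ suc n → ⟦ suc n ⟧ * term (suc n) i ≡ left i + right i
    split i i≤ = trans
      (cong (_* term (suc n) i) (trans (cong ⟦_⟧ (sym (ℕₚ.m+[n∸m]≡n i≤))) (⟦⟧-homo-+ i (suc n ℕ.∸ i))))
      (regroup ⟦ i ⟧ ⟦ suc n ℕ.∸ i ⟧ (expTerm a i) (expTerm b (suc n ℕ.∸ i)))
    leftSum : ∑ (2 ℕ.+ n) left ≡ a * conv n
    leftSum = begin
      ∑ (2 ℕ.+ n) left                      ≡⟨ ∑-head (suc n) left ⟩
      left 0 + ∑ (suc n) (left ∘ suc)       ≡⟨ cong₂ _+_ (zero* (expTerm a 0) (expTerm b (suc n)))
        (∑-cong (suc n) (λ i _ → trans (cong (_* expTerm b (n ℕ.∸ i)) (expTerm-suc a i)) (*-assoc a (expTerm a i) (expTerm b (n ℕ.∸ i))))) ⟩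
      0ℚ + ∑ (suc n) (λ i → a * term n i)   ≡⟨ +-identityˡ _ ⟩
      ∑ (suc n) (λ i → a * term n i)        ≡⟨ *-distribˡ-∑ (suc n) a (term n) ⟩
      a * conv n                            ∎
      where
      zero* : ∀ x y → 0ℚ * x * y ≡ 0ℚ
      zero* = solve-∀ ring
    rightSum : ∑ (2 ℕ.+ n) right ≡ b * conv n
    rightSum = begin
      ∑ (suc n) right + right (suc n)
        ≡⟨ cong₂ _+_ (∑-cong (suc n) (λ i i< → body i (ℕₚ.≤-pred i<))) last ⟩
      ∑ (suc n) (λ i → b * term n i) + 0ℚ   ≡⟨ +-identityʳ _ ⟩
      ∑ (suc n) (λ i → b * term n i)        ≡⟨ *-distribˡ-∑ (suc n) b (term n) ⟩
      b * conv n                            ∎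
      where
      zero* : ∀ x y → x * (0ℚ * y) ≡ 0ℚ
      zero* = solve-∀ ring
      swap : ∀ x b y → x * (b * y) ≡ b * (x * y)
      swap = solve-∀ ring
      body : ∀ i → i ℕ.≤ n → right i ≡ b * term n i
      body i i≤n rewrite ℕₚ.+-∸-assoc 1 i≤n =
        trans (cong (expTerm a i *_) (expTerm-suc b (n ℕ.∸ i))) (swap (expTerm a i) b (expTerm b (n ℕ.∸ i)))
      last : right (suc n) ≡ 0ℚ
      last rewrite ℕₚ.n∸n≡0 n = zero* (expTerm a (suc n)) (expTerm b 0)

  -- The truncation keeps the triangle `i + j < n` of the product. Enlarging the triangle to a
  -- square gives `exp-+-≤`; fitting a rectangle into a larger triangle gives `exp-*-≤`.
  exp-+ : ∀ a b n → exp< n (a + b) ≡ ∑ n (λ i → expTerm a i * exp< (n ℕ.∸ i) b)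
  exp-+ a b zero    = refl
  exp-+ a b (suc n) = begin
    exp< n (a + b) + expTerm (a + b) n
      ≡⟨ cong₂ _+_ (exp-+ a b n) (sym (expTerm-+ a b n)) ⟩
    ∑ n old + (∑ n new + new n)
      ≡⟨ +-assoc (∑ n old) (∑ n new) (new n) ⟨
    ∑ n old + ∑ n new + new n
      ≡⟨ cong₂ _+_ (sym (∑-distrib-+ n old new)) last ⟩
    ∑ n (λ i → old i + new i) + expTerm a n * exp< (suc n ℕ.∸ n) b
      ≡⟨ cong (_+ expTerm a n * exp< (suc n ℕ.∸ n) b) (∑-cong n body) ⟩
    ∑ n (λ i → expTerm a i * exp< (suc n ℕ.∸ i) b) + expTerm a n * exp< (suc n ℕ.∸ n) b ∎
    where
    open ≡-Reasoning
    old new : ℕ → ℚ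
    old i = expTerm a i * exp< (n ℕ.∸ i) b
    new i = expTerm a i * expTerm b (n ℕ.∸ i)
    body : ∀ i → i ℕ.< n → old i + new i ≡ expTerm a i * exp< (suc n ℕ.∸ i) b
    body i i<n rewrite ℕₚ.+-∸-assoc 1 (ℕₚ.<⇒≤ i<n) =
      sym (*-distribˡ-+ (expTerm a i) (exp< (n ℕ.∸ i) b) (expTerm b (n ℕ.∸ i)))
    last : new n ≡ expTerm a n * exp< (suc n ℕ.∸ n) b
    last rewrite ℕₚ.+-∸-assoc 1 (ℕₚ.≤-refl {n}) | ℕₚ.n∸n≡0 n = cong (expTerm a n *_) (sym (+-identityˡ (expTerm b 0)))

  exp-+-≤ : ∀ {a b} → 0ℚ ≤ a → 0ℚ ≤ b → ∀ n → exp< n (a + b) ≤ exp< n a * exp< n b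
  exp-+-≤ {a} {b} 0≤a 0≤b n = subst₂ _≤_ (sym (exp-+ a b n)) (*-distribʳ-∑ n (exp< n b) (expTerm a))
    (∑-mono n (λ i _ → *-monoʳ (0≤expTerm 0≤a i) (exp-monoˡ 0≤b (ℕₚ.m∸n≤m n i))))

  exp-*-≤ : ∀ {a b} → 0ℚ ≤ a → 0ℚ ≤ b → ∀ m n → exp< m a * exp< n b ≤ exp< (m ℕ.+ n) (a + b)
  exp-*-≤ {a} {b} 0≤a 0≤b m n = subst₂ _≤_ (*-distribʳ-∑ m (exp< n b) (expTerm a)) (sym (exp-+ a b (m ℕ.+ n)))
    (≤-trans
      (∑-mono m (λ i i<m → *-monoʳ (0≤expTerm 0≤a i) (exp-monoˡ 0≤b (n≤m+n∸i i (ℕₚ.<⇒≤ i<m)))))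
      (∑-monoˡ (λ i → 0≤* (0≤expTerm 0≤a i) (0≤exp 0≤b (m ℕ.+ n ℕ.∸ i))) (ℕₚ.m≤m+n m n)))
    where
    n≤m+n∸i : ∀ i → i ℕ.≤ m → n ℕ.≤ m ℕ.+ n ℕ.∸ i
    n≤m+n∸i i i≤m = subst (ℕ._≤ m ℕ.+ n ℕ.∸ i) (ℕₚ.m+n∸m≡n m n) (ℕₚ.∸-monoʳ-≤ (m ℕ.+ n) i≤m)

  ⟦suc⟧* : ∀ k a → ⟦ suc k ⟧ * a ≡ a + ⟦ k ⟧ * a
  ⟦suc⟧* k a = trans (cong (_* a) (⟦⟧-suc k)) (distrib a ⟦ k ⟧)
    where
    distrib : ∀ a x → (1ℚ + x) * a ≡ a + x * a
    distrib = solve-∀ ring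

  exp-suc : ∀ n a → exp< (suc n) a ≡ 1ℚ + ∑ n (expTerm a ∘ suc)
  exp-suc n a = ∑-head n (expTerm a)

  1≤exp : ∀ {a} → 0ℚ ≤ a → ∀ n → 1ℚ ≤ exp< (suc n) a
  1≤exp {a} 0≤a n = subst (1ℚ ≤_) (sym (exp-suc n a)) (p≤p+q (0≤∑ n (0≤expTerm 0≤a ∘ suc)))

  exp-^-≤ : ∀ {a} → 0ℚ ≤ a → ∀ n k → exp< n a ^ suc k ≤ exp< (suc k ℕ.* n) (⟦ suc k ⟧ * a)
  exp-^-≤ {a} 0≤a n zero    = ≤-reflexive (trans (*-identityʳ (exp< n a))
    (cong₂ exp< (sym (ℕₚ.*-identityˡ n)) (sym (*-identityˡ a))))
  exp-^-≤ {a} 0≤a n (suc k) = begin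
    exp< n a * exp< n a ^ suc k                           ≤⟨ *-monoʳ (0≤exp 0≤a n) (exp-^-≤ 0≤a n k) ⟩
    exp< n a * exp< (suc k ℕ.* n) (⟦ suc k ⟧ * a)         ≤⟨ exp-*-≤ 0≤a (0≤* (0≤⟦⟧ (suc k)) 0≤a) n (suc k ℕ.* n) ⟩
    exp< (n ℕ.+ suc k ℕ.* n) (a + ⟦ suc k ⟧ * a)          ≡⟨ cong (exp< (n ℕ.+ suc k ℕ.* n)) (⟦suc⟧* (suc k) a) ⟨
    exp< (n ℕ.+ suc k ℕ.* n) (⟦ 2 ℕ.+ k ⟧ * a)            ∎
    where open ≤-Reasoning

  exp-⟦⟧*-≤ : ∀ {a} → 0ℚ ≤ a → ∀ n d → exp< (suc n) (⟦ d ⟧ * a) ≤ exp< (suc n) a ^ d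
  exp-⟦⟧*-≤ {a} 0≤a n zero    = ≤-reflexive (trans (exp-suc n (0ℚ * a)) (trans (cong (λ x → 1ℚ + x) (vanish n)) (+-identityʳ 1ℚ)))
    where
    zero* : ∀ a x y → 0ℚ * a * x * y ≡ 0ℚ
    zero* = solve-∀ ring
    vanish : ∀ n → ∑ n (expTerm (0ℚ * a) ∘ suc) ≡ 0ℚ
    vanish zero    = refl
    vanish (suc n) = trans (cong₂ _+_ (vanish n) (zero* a ((0ℚ * a) ^ n) (inv! (suc n)))) (+-identityʳ 0ℚ)
  exp-⟦⟧*-≤ {a} 0≤a n (suc d) = begin
    exp< (suc n) (⟦ suc d ⟧ * a)                 ≡⟨ cong (exp< (suc n)) (⟦suc⟧* d a) ⟩
    exp< (suc n) (a + ⟦ d ⟧ * a)                 ≤⟨ exp-+-≤ 0≤a (0≤* (0≤⟦⟧ d) 0≤a) (suc n) ⟩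
    exp< (suc n) a * exp< (suc n) (⟦ d ⟧ * a)    ≤⟨ *-monoʳ (0≤exp 0≤a (suc n)) (exp-⟦⟧*-≤ 0≤a n d) ⟩
    exp< (suc n) a * exp< (suc n) a ^ d          ∎
    where open ≤-Reasoning

  2ℚ : ℚ
  2ℚ = ⟦ 2 ⟧

  -- For `s < 2` this is `exp s ≤ (2+s)/(2-s)`, whose expansion has coefficients `1/2^(i-1)` against
  -- `1/i!`. The right side can be inverted by algebra, and that is how `w` is found later.
  [2-s]*exp≤2+s : ∀ {s} → 0ℚ ≤ s → ∀ n → (2ℚ - s) * exp< (2 ℕ.+ n) s ≤ 2ℚ + s
  [2-s]*exp≤2+s {s} 0≤s n = ≤-trans (p≤p+q (0≤* 0≤s (0≤expTerm 0≤s (suc n)))) (go n)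
    where
    open ≤-Reasoning
    base : ∀ s → (2ℚ - s) * (0ℚ + 1ℚ * 1ℚ + s * 1ℚ * 1ℚ) + s * (s * 1ℚ * 1ℚ) ≡ 2ℚ + s
    base = solve-∀ ring
    regroup : ∀ s S t → (2ℚ - s) * (S + t) + s * t ≡ (2ℚ - s) * S + 2ℚ * t
    regroup = solve-∀ ring
    ratio : ∀ n → 2ℚ * expTerm s (2 ℕ.+ n) ≤ s * expTerm s (suc n)
    ratio n = ≤-trans (*-monoˡ (0≤expTerm 0≤s (2 ℕ.+ n)) (⟦⟧-mono {2} {2 ℕ.+ n} (s≤s (s≤s z≤n))))
      (≤-reflexive (expTerm-suc s (suc n)))
    -- The extra summand closes the induction: a new term `t` turns it into `2 t`, and
    -- `2 t ≤ (n+2) t = s * expTerm s (n+1)`.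
    go : ∀ n → (2ℚ - s) * exp< (2 ℕ.+ n) s + s * expTerm s (suc n) ≤ 2ℚ + s
    go zero    = ≤-reflexive (base s)
    go (suc n) = begin
      (2ℚ - s) * (exp< (2 ℕ.+ n) s + expTerm s (2 ℕ.+ n)) + s * expTerm s (2 ℕ.+ n)
        ≡⟨ regroup s (exp< (2 ℕ.+ n) s) (expTerm s (2 ℕ.+ n)) ⟩
      (2ℚ - s) * exp< (2 ℕ.+ n) s + 2ℚ * expTerm s (2 ℕ.+ n)
        ≤⟨ +-monoʳ-≤ ((2ℚ - s) * exp< (2 ℕ.+ n) s) (ratio n) ⟩
      (2ℚ - s) * exp< (2 ℕ.+ n) s + s * expTerm s (suc n)
        ≤⟨ go n ⟩
      2ℚ + s ∎

  -- Partial sums of the exponential at negative arguments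

  sgn : ℕ → ℚ
  sgn n = (- 1ℚ) ^ n

  sgn-+ : ∀ m n → sgn (m ℕ.+ n) ≡ sgn m * sgn n
  sgn-+ = ^-homo-* (- 1ℚ)

  sgn² : ∀ n → sgn n * sgn n ≡ 1ℚ
  sgn² zero    = refl
  sgn² (suc n) = trans (cancel-neg (sgn n)) (sgn² n)
    where
    cancel-neg : ∀ x → (- 1ℚ * x) * (- 1ℚ * x) ≡ x * x
    cancel-neg = solve-∀ ring

  expTerm-neg : ∀ a n → expTerm (- a) n ≡ sgn n * expTerm a n
  expTerm-neg a n = trans (cong (_* inv! n) (trans (cong (_^ n) (-a≡-1*a a)) (^-distrib-* (- 1ℚ) a n)))
    (*-assoc (sgn n) (a ^ n) (inv! n))
    where
    -a≡-1*a : ∀ a → - a ≡ - 1ℚ * a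
    -a≡-1*a = solve-∀ ring

  -- For an even number of terms both sides are nonnegative, so the truncation of exp (-a) stays below 1;
  -- this is what excludes a negative logarithm of a number above 1.
  module _ (a : ℚ) where
    private
      e : ℕ → ℚ
      e = expTerm a

      q : ℕ → ℕ → ℚ
      q m r = + 1 / suc (m ℕ.+ r)

      c : ℕ → ℕ → ℚ
      c n r = 1ℚ + sgn (n ℕ.+ r)

      -- The coefficient of `a^(m+r+1)` in the product of the two truncations is a stretch of an
      -- alternating binomial sum. Each end of the stretch collapses to the binomial coefficient of
      -- `m+r` over `m`, and dividing by `(m+r+1)!` leaves `1/(m! r! (m+r+1))`. The two ends
      -- reinforce or cancel by parity, so `c` is 2 or 0.
      G : ℕ → ℚ
      G m = ∑ (suc m) (λ r → c (suc m) r * (e r * q m r))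

    1-exp*exp-neg : ∀ m → 1ℚ - exp< (suc m) (- a) * exp< (suc m) a ≡ sgn (suc m) * (a * e m) * G m
    1-exp*exp-neg zero    = base a
      where
      base : ∀ a → 1ℚ - (0ℚ + 1ℚ * 1ℚ) * (0ℚ + 1ℚ * 1ℚ) ≡ - 1ℚ * 1ℚ * (a * (1ℚ * 1ℚ)) * (0ℚ + (1ℚ + - 1ℚ * 1ℚ) * (1ℚ * 1ℚ * 1ℚ))
      base = solve-∀ ring
    1-exp*exp-neg (suc m) = begin
      1ℚ - (A + expTerm (- a) n) * (B + e n)
        ≡⟨ cong (λ x → 1ℚ - (A + x) * (B + e n)) (expTerm-neg a n) ⟩
      1ℚ - (A + σ * e n) * (B + e n)
        ≡⟨ expand A B σ (e n) ⟩
      (1ℚ - A * B) - e n * (σ * B + A) - σ * e n * e n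
        ≡⟨ cong₂ (λ x y → x - e n * y - σ * e n * e n) (1-exp*exp-neg m) σB+A≡σY ⟩
      σ * (a * e m) * G m - e n * (σ * Y) - σ * e n * e n
        ≡⟨ cong₂ (λ x y → σ * x * G m - e n * (σ * y) - σ * e n * e n) (sym (expTerm-suc a m)) Y≡nG+Z ⟩
      σ * (⟦ n ⟧ * e n) * G m - e n * (σ * (⟦ n ⟧ * G m + Z)) - σ * e n * e n
        ≡⟨ collect σ ⟦ n ⟧ (e n) (G m) Z ⟩
      - 1ℚ * σ * (e n * (Z + e n))
        ≡⟨ cong (λ x → - 1ℚ * σ * (e n * x)) aG≡Z+e ⟨
      - 1ℚ * σ * (e n * (a * G n))
        ≡⟨ rotate (- 1ℚ * σ) (e n) a (G n) ⟩
      sgn (suc n) * (a * e n) * G n ∎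
      where
      open ≡-Reasoning
      n = suc m
      σ = sgn n
      A = exp< n (- a)
      B = exp< n a
      F : ℕ → ℚ
      F r = c n r * (⟦ r ⟧ * e r * q m r)
      Y = ∑ n (λ r → c n r * e r)
      Z = ∑ n F

      expand : ∀ A B σ e → 1ℚ - (A + σ * e) * (B + e) ≡ (1ℚ - A * B) - e * (σ * B + A) - σ * e * e
      expand = solve-∀ ring
      collect : ∀ σ n e G Z → σ * (n * e) * G - e * (σ * (n * G + Z)) - σ * e * e ≡ - 1ℚ * σ * (e * (Z + e))
      collect = solve-∀ ring
      rotate : ∀ σ e a G → σ * (e * (a * G)) ≡ σ * (a * e) * G
      rotate = solve-∀ ring

      σB+A≡σY : σ * B + A ≡ σ * Y
      σB+A≡σY = begin
        σ * B + A                                     ≡⟨ cong (_+ A) (*-distribˡ-∑ n σ e) ⟨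
        ∑ n (λ r → σ * e r) + A                       ≡⟨ ∑-distrib-+ n (λ r → σ * e r) (expTerm (- a)) ⟨
        ∑ n (λ r → σ * e r + expTerm (- a) r)         ≡⟨ ∑-cong n (λ r _ → term r) ⟩
        ∑ n (λ r → σ * (c n r * e r))                 ≡⟨ *-distribˡ-∑ n σ (λ r → c n r * e r) ⟩
        σ * Y                                         ∎
        where
        unfold : ∀ σ τ e → σ * ((1ℚ + σ * τ) * e) ≡ σ * e + (σ * σ) * τ * e
        unfold = solve-∀ ring
        term : ∀ r → σ * e r + expTerm (- a) r ≡ σ * (c n r * e r)
        term r = sym (begin
          σ * ((1ℚ + sgn (n ℕ.+ r)) * e r)            ≡⟨ cong (λ x → σ * ((1ℚ + x) * e r)) (sgn-+ n r) ⟩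
          σ * ((1ℚ + σ * sgn r) * e r)                ≡⟨ unfold σ (sgn r) (e r) ⟩
          σ * e r + (σ * σ) * sgn r * e r             ≡⟨ cong (λ x → σ * e r + x * sgn r * e r) (sgn² n) ⟩
          σ * e r + 1ℚ * sgn r * e r                  ≡⟨ cong (λ x → σ * e r + x * e r) (*-identityˡ (sgn r)) ⟩
          σ * e r + sgn r * e r                       ≡⟨ cong (λ x → σ * e r + x) (expTerm-neg a r) ⟨
          σ * e r + expTerm (- a) r                   ∎)

      -- Insert `(n+r) * q m r = 1`: the `n` part cancels the induction hypothesis, and the `r` part
      -- is `Z`.
      Y≡nG+Z : Y ≡ ⟦ n ⟧ * G m + Z
      Y≡nG+Z = begin
        Y                                                               ≡⟨ ∑-cong n (λ r _ → term r) ⟩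
        ∑ n (λ r → ⟦ n ⟧ * (c n r * (e r * q m r)) + F r)               ≡⟨ ∑-distrib-+ n (λ r → ⟦ n ⟧ * (c n r * (e r * q m r))) F ⟩
        ∑ n (λ r → ⟦ n ⟧ * (c n r * (e r * q m r))) + Z                 ≡⟨ cong (_+ Z) (*-distribˡ-∑ n ⟦ n ⟧ (λ r → c n r * (e r * q m r))) ⟩
        ⟦ n ⟧ * G m + Z                                                 ∎
        where
        spread : ∀ c e q n r → c * e * ((n + r) * q) ≡ n * (c * (e * q)) + c * (r * e * q)
        spread = solve-∀ ring
        term : ∀ r → c n r * e r ≡ ⟦ n ⟧ * (c n r * (e r * q m r)) + F r
        term r = begin
          c n r * e r                                    ≡⟨ *-identityʳ _ ⟨
          c n r * e r * 1ℚ                               ≡⟨ cong (c n r * e r *_) (⟦n⟧*1/n≡1 (n ℕ.+ r)) ⟨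
          c n r * e r * (⟦ n ℕ.+ r ⟧ * q m r)            ≡⟨ cong (λ x → c n r * e r * (x * q m r)) (⟦⟧-homo-+ n r) ⟩
          c n r * e r * ((⟦ n ⟧ + ⟦ r ⟧) * q m r)        ≡⟨ spread (c n r) (e r) (q m r) ⟦ n ⟧ ⟦ r ⟧ ⟩
          ⟦ n ⟧ * (c n r * (e r * q m r)) + F r          ∎

      -- After the index shift two terms stick out of `Z`: at `r = n` the weight is 2 and
      -- `2n/(n+n) = 1` leaves `e n`; at `r = n+1` parity gives 0.
      aG≡Z+e : a * G n ≡ Z + e n
      aG≡Z+e = begin
        a * G n                                            ≡⟨ *-distribˡ-∑ (suc n) a (λ r → c (suc n) r * (e r * q n r)) ⟨
        ∑ (suc n) (λ r → a * (c (suc n) r * (e r * q n r))) ≡⟨ ∑-cong (suc n) (λ r _ → shift r) ⟩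
        ∑ (suc n) (F ∘ suc)                                ≡⟨ +-identityˡ _ ⟨
        0ℚ + ∑ (suc n) (F ∘ suc)                           ≡⟨ cong (_+ ∑ (suc n) (F ∘ suc)) (F0≡0 (c n 0) (e 0) (q m 0)) ⟨
        F 0 + ∑ (suc n) (F ∘ suc)                          ≡⟨ ∑-head (suc n) F ⟨
        Z + F n + F (suc n)                                ≡⟨ cong₂ (λ x y → Z + x + y) Fn≡e F[1+n]≡0 ⟩
        Z + e n + 0ℚ                                       ≡⟨ +-identityʳ _ ⟩
        Z + e n                                            ∎
        where
        F0≡0 : ∀ c e q → c * (0ℚ * e * q) ≡ 0ℚ
        F0≡0 = solve-∀ ring
        pull : ∀ a c e q → a * (c * (e * q)) ≡ c * (a * e * q)
        pull = solve-∀ ring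
        shift : ∀ r → a * (c (suc n) r * (e r * q n r)) ≡ F (suc r)
        shift r = begin
          a * (c (suc n) r * (e r * q n r))                  ≡⟨ pull a (c (suc n) r) (e r) (q n r) ⟩
          c (suc n) r * (a * e r * q n r)                    ≡⟨ cong (λ x → c (suc n) r * (x * q n r)) (expTerm-suc a r) ⟨
          c (suc n) r * (⟦ suc r ⟧ * e (suc r) * q n r)      ≡⟨ cong (λ i → (1ℚ + sgn (suc i)) * (⟦ suc r ⟧ * e (suc r) * (+ 1 / suc i))) (sym (ℕₚ.+-suc m r)) ⟩
          F (suc r)                                          ∎
        double : ∀ n e q → (1ℚ + 1ℚ) * (n * e * q) ≡ e * ((n + n) * q)
        double = solve-∀ ring
        Fn≡e : F n ≡ e n
        Fn≡e = begin
          (1ℚ + sgn (n ℕ.+ n)) * (⟦ n ⟧ * e n * q m n)    ≡⟨ cong (λ x → (1ℚ + x) * (⟦ n ⟧ * e n * q m n)) (trans (sgn-+ n n) (sgn² n)) ⟩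
          (1ℚ + 1ℚ) * (⟦ n ⟧ * e n * q m n)               ≡⟨ double ⟦ n ⟧ (e n) (q m n) ⟩
          e n * ((⟦ n ⟧ + ⟦ n ⟧) * q m n)                 ≡⟨ cong (λ x → e n * (x * q m n)) (⟦⟧-homo-+ n n) ⟨
          e n * (⟦ n ℕ.+ n ⟧ * q m n)                     ≡⟨ cong (e n *_) (⟦n⟧*1/n≡1 (n ℕ.+ n)) ⟩
          e n * 1ℚ                                        ≡⟨ *-identityʳ (e n) ⟩
          e n                                             ∎
        odd : ∀ x → (1ℚ + - 1ℚ * 1ℚ) * x ≡ 0ℚ
        odd = solve-∀ ring
        F[1+n]≡0 : F (suc n) ≡ 0ℚ
        F[1+n]≡0 = trans
          (cong (λ x → (1ℚ + x) * (⟦ suc n ⟧ * e (suc n) * q m (suc n)))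
            (trans (cong sgn (ℕₚ.+-suc n n)) (cong (- 1ℚ *_) (trans (sgn-+ n n) (sgn² n)))))
          (odd (⟦ suc n ⟧ * e (suc n) * q m (suc n)))

  0≤1+sgn : ∀ n → 0ℚ ≤ 1ℚ + sgn n
  0≤1+sgn zero          = nonNegative⁻¹ (1ℚ + 1ℚ)
  0≤1+sgn (suc zero)    = ≤-refl
  0≤1+sgn (suc (suc n)) = subst (λ x → 0ℚ ≤ 1ℚ + x) (two (sgn n)) (0≤1+sgn n)
    where
    two : ∀ x → x ≡ - 1ℚ * (- 1ℚ * x)
    two = solve-∀ ring

  -- An even number of terms, written `suc j + suc j`, makes `1 - A * B` nonnegative. Then
  -- `A ≤ A * B ≤ 1` because `B ≥ 1`; the first of these steps needs `0 ≤ A`, hence the case split.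
  exp-neg≤1 : ∀ {a} → 0ℚ ≤ a → ∀ j → exp< (suc j ℕ.+ suc j) (- a) ≤ 1ℚ
  exp-neg≤1 {a} 0≤a j with ≤-total (exp< (suc j ℕ.+ suc j) (- a)) 0ℚ
  ... | inj₁ A≤0 = ≤-trans A≤0 0≤1
  ... | inj₂ 0≤A = begin
    A           ≡⟨ *-identityʳ A ⟨
    A * 1ℚ      ≤⟨ *-monoʳ 0≤A (1≤exp 0≤a m) ⟩
    A * B       ≤⟨ 0≤q-p⇒p≤q (subst (0ℚ ≤_) (sym (1-exp*exp-neg a m)) 0≤rhs) ⟩
    1ℚ          ∎
    where
    open ≤-Reasoning
    m = j ℕ.+ suc j
    A = exp< (suc m) (- a)
    B = exp< (suc m) a
    0≤rhs = 0≤* (0≤* (subst (0ℚ ≤_) (sym (trans (sgn-+ (suc j) (suc j)) (sgn² (suc j)))) 0≤1) (0≤* 0≤a (0≤expTerm 0≤a m)))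
      (0≤∑ (suc m) (λ r → 0≤* (0≤1+sgn (suc m ℕ.+ r)) (0≤* (0≤expTerm 0≤a r) (nonNegative⁻¹ _ {{normalize-nonNeg 1 (suc (m ℕ.+ r))}}))))

  -- The tail estimate

  exp≤1+2s : ∀ {s} → 0ℚ ≤ s → s ≤ 1ℚ → ∀ n → exp< (2 ℕ.+ n) s ≤ 1ℚ + 2ℚ * s
  exp≤1+2s {s} 0≤s s≤1 n = *-cancelˡ-≤ 0<2-s (begin
    (2ℚ - s) * exp< (2 ℕ.+ n) s                   ≤⟨ [2-s]*exp≤2+s 0≤s n ⟩
    2ℚ + s                                        ≤⟨ p≤p+q (0≤* (0≤* (0≤⟦⟧ 2) 0≤s) (p≤q⇒0≤q-p s≤1)) ⟩
    2ℚ + s + 2ℚ * s * (1ℚ - s)                    ≡⟨ factor s ⟩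
    (2ℚ - s) * (1ℚ + 2ℚ * s)                      ∎)
    where
    open ≤-Reasoning
    factor : ∀ s → 2ℚ + s + 2ℚ * s * (1ℚ - s) ≡ (2ℚ - s) * (1ℚ + 2ℚ * s)
    factor = solve-∀ ring
    0<2-s : 0ℚ < 2ℚ - s
    0<2-s = p<q⇒0<q-p {s} {2ℚ} (≤-<-trans s≤1 (*<* (ℤ.+<+ (s≤s (s≤s z≤n)))))

  -- Chernoff's bound in the parametrisation z = k h, p = (1 - z)/k, c = 1 - z = 1/t:
  -- (1 + h)ᵈ cʲ is the moment generating function bound E tˣ / tʲ for X ~ Bin(d, p),
  -- and w = z²/(2 - z) satisfies exp (w + z) ≤ 1/c.
  module Chernoff
    (k-1 : ℕ) {h z w : ℚ} (0≤h : 0ℚ ≤ h) (z≡kh : ⟦ suc k-1 ⟧ * h ≡ z)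
    (z≤½ : z ≤ ½) (0≤w : 0ℚ ≤ w) ([2-z]w≡z² : (2ℚ - z) * w ≡ z * z)
    where

    open ≤-Reasoning

    private
      k = suc k-1

    c : ℚ
    c = 1ℚ - z

    0≤z : 0ℚ ≤ z
    0≤z = subst (0ℚ ≤_) z≡kh (0≤* (0≤⟦⟧ k) 0≤h)

    ½≤c : ½ ≤ c
    ½≤c = +-monoʳ-≤ 1ℚ (neg-antimono-≤ z≤½)

    0≤c : 0ℚ ≤ c
    0≤c = ≤-trans (nonNegative⁻¹ ½) ½≤c

    c≤1 : c ≤ 1ℚ
    c≤1 = +-monoʳ-≤ 1ℚ (neg-antimono-≤ 0≤z)

    0≤1+h : 0ℚ ≤ 1ℚ + h
    0≤1+h = 0≤+ 0≤1 0≤h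

    w≤½ : w ≤ ½
    w≤½ = begin
      w                ≡⟨ *-identityˡ w ⟨
      1ℚ * w           ≤⟨ *-monoˡ 0≤w (≤-trans (p≤p+q {1ℚ} 0≤c) (≤-reflexive (shift z))) ⟩
      (2ℚ - z) * w     ≡⟨ [2-z]w≡z² ⟩
      z * z            ≤⟨ *-mono 0≤z (≤-trans 0≤z (≤-trans z≤½ ½≤1)) z≤½ (≤-trans z≤½ ½≤1) ⟩
      ½ * 1ℚ           ≡⟨ *-identityʳ ½ ⟩
      ½                ∎
      where
      shift : ∀ z → 1ℚ + (1ℚ - z) ≡ 2ℚ - z
      shift = solve-∀ ring

    -- At `s = w + z` the bound `(2+s)/(2-s)` is exactly `1/c`: the equation for `w` gives
    -- `(2-z)(2-s) = 4c` and `(2-z)(2+s) = 4`. This explains the multipliers 4 and `2-z`.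
    c*exp[w+z]≤1 : ∀ n → c * exp< n (w + z) ≤ 1ℚ
    c*exp[w+z]≤1 n = *-cancelˡ-≤ (0<⟦⟧ 4) (begin
      ⟦ 4 ⟧ * (c * exp< n (w + z))                ≤⟨ *-monoʳ (0≤⟦⟧ 4) (*-monoʳ 0≤c (exp-monoˡ 0≤w+z (ℕₚ.m≤n+m n 2))) ⟩
      ⟦ 4 ⟧ * (c * X)                             ≡⟨ lhs z w X ⟩
      ((2ℚ - z) * (2ℚ - (w + z)) + ((2ℚ - z) * w - z * z)) * X
                                                  ≡⟨ cong (λ x → ((2ℚ - z) * (2ℚ - (w + z)) + x) * X) zero-diff ⟩
      ((2ℚ - z) * (2ℚ - (w + z)) + 0ℚ) * X        ≡⟨ assoc (2ℚ - z) (2ℚ - (w + z)) X ⟩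
      (2ℚ - z) * ((2ℚ - (w + z)) * X)             ≤⟨ *-monoʳ 0≤2-z ([2-s]*exp≤2+s 0≤w+z n) ⟩
      (2ℚ - z) * (2ℚ + (w + z))                   ≡⟨ rhs z w ⟩
      ⟦ 4 ⟧ * 1ℚ + ((2ℚ - z) * w - z * z)         ≡⟨ cong (λ x → ⟦ 4 ⟧ * 1ℚ + x) zero-diff ⟩
      ⟦ 4 ⟧ * 1ℚ + 0ℚ                             ≡⟨ +-identityʳ (⟦ 4 ⟧ * 1ℚ) ⟩
      ⟦ 4 ⟧ * 1ℚ                                  ∎)
      where
      X = exp< (2 ℕ.+ n) (w + z)
      0≤w+z = 0≤+ 0≤w 0≤z
      zero-diff : (2ℚ - z) * w - z * z ≡ 0ℚ
      zero-diff = trans (cong (_- z * z) [2-z]w≡z²) (+-inverseʳ (z * z))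
      lhs : ∀ z w X → ⟦ 4 ⟧ * ((1ℚ - z) * X) ≡ ((2ℚ - z) * (2ℚ - (w + z)) + ((2ℚ - z) * w - z * z)) * X
      lhs = solve-∀ ring
      rhs : ∀ z w → (2ℚ - z) * (2ℚ + (w + z)) ≡ ⟦ 4 ⟧ * 1ℚ + ((2ℚ - z) * w - z * z)
      rhs = solve-∀ ring
      assoc : ∀ a b X → (a * b + 0ℚ) * X ≡ a * (b * X)
      assoc = solve-∀ ring
      shift : ∀ z → 1ℚ + (1ℚ - z) ≡ 2ℚ - z
      shift = solve-∀ ring
      0≤2-z : 0ℚ ≤ 2ℚ - z
      0≤2-z = subst (0ℚ ≤_) (shift z) (0≤+ 0≤1 0≤c)

    [1+h]^k≤exp : (1ℚ + h) ^ k ≤ exp< (k ℕ.* 2) z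
    -- `1 + h` is the two-term truncation `exp< 2 h`.
    [1+h]^k≤exp = subst₂ _≤_ (cong (_^ k) (two h)) (cong (exp< (k ℕ.* 2)) z≡kh) (exp-^-≤ 0≤h 2 k-1)
      where
      two : ∀ h → 0ℚ + 1ℚ * 1ℚ + h * 1ℚ * 1ℚ ≡ 1ℚ + h
      two = solve-∀ ring

    exp*[1+h]^k*c≤1 : ∀ n → exp< n w * (1ℚ + h) ^ k * c ≤ 1ℚ
    exp*[1+h]^k*c≤1 n = begin
      exp< n w * (1ℚ + h) ^ k * c             ≤⟨ *-monoˡ 0≤c (*-monoʳ (0≤exp 0≤w n) [1+h]^k≤exp) ⟩
      exp< n w * exp< (k ℕ.* 2) z * c         ≤⟨ *-monoˡ 0≤c (exp-*-≤ 0≤w 0≤z n (k ℕ.* 2)) ⟩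
      exp< (n ℕ.+ k ℕ.* 2) (w + z) * c        ≡⟨ *-comm (exp< (n ℕ.+ k ℕ.* 2) (w + z)) c ⟩
      c * exp< (n ℕ.+ k ℕ.* 2) (w + z)        ≤⟨ c*exp[w+z]≤1 (n ℕ.+ k ℕ.* 2) ⟩
      1ℚ                                      ∎

    -- Chernoff's bound `Q ≤ exp (-r)` in product form, compared after raising to the power `k`.
    -- Then `c ^ j` becomes `c ^ (j k)`, at most `c ^ d` since `c ≤ 1`, and `d` copies of
    -- `exp w * (1+h)^k * c ≤ 1` can be split off. The surplus `η` in the degree costs one factor
    -- `exp (η w) ≤ 1 + η`.
    exp-tail : ∀ {r η} → 0ℚ ≤ r → 0ℚ ≤ η → η ≤ 1ℚ → ∀ {d j} → d ℕ.≤ j ℕ.* k →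
      ⟦ k ⟧ * r ≡ (⟦ d ⟧ + η) * w → ∀ n → exp< (suc n) r * ((1ℚ + h) ^ d * c ^ j) ≤ 1ℚ + η
    exp-tail {r} {η} 0≤r 0≤η η≤1 {d} {j} d≤jk kr≡ n =
      ^-cancel-≤ k (p≤p+q 0≤η) (begin
        (Er * ((1ℚ + h) ^ d * c ^ j)) ^ k                 ≡⟨ trans (^-distrib-* Er _ k) (cong (Er ^ k *_) (^-distrib-* ((1ℚ + h) ^ d) (c ^ j) k)) ⟩
        Er ^ k * (((1ℚ + h) ^ d) ^ k * (c ^ j) ^ k)       ≡⟨ cong₂ (λ x y → Er ^ k * (x * y)) swap-^ (^-assocʳ c j k) ⟩
        Er ^ k * (Eh ^ d * c ^ (j ℕ.* k))                 ≤⟨ *-mono (0≤^ 0≤Er k) (0≤* (0≤^ 0≤Eh d) (0≤^ 0≤c d)) Er^k≤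
                                                              (*-monoʳ (0≤^ 0≤Eh d) (^-antimonoʳ 0≤c c≤1 d≤jk)) ⟩
        Ew ^ d * Eη * (Eh ^ d * c ^ d)                    ≡⟨ regroup (Ew ^ d) Eη (Eh ^ d) (c ^ d) ⟩
        Ew ^ d * Eh ^ d * c ^ d * Eη                      ≡⟨ cong (_* Eη) (trans (^-distrib-* (Ew * Eh) c d) (cong (_* c ^ d) (^-distrib-* Ew Eh d))) ⟨
        (Ew * Eh * c) ^ d * Eη                            ≤⟨ *-monoˡ (0≤exp 0≤ηw M) (p^n≤1 (0≤* (0≤* (0≤exp 0≤w M) 0≤Eh) 0≤c) (exp*[1+h]^k*c≤1 M) d) ⟩
        1ℚ * Eη                                           ≡⟨ *-identityˡ Eη ⟩
        Eη                                                ≤⟨ Eη≤ ⟩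
        1ℚ + η                                            ∎)
      where
      M = k ℕ.* suc n
      Er = exp< (suc n) r
      Ew = exp< M w
      Eη = exp< M (η * w)
      Eh = (1ℚ + h) ^ k
      0≤Er = 0≤exp 0≤r (suc n)
      0≤Eh = 0≤^ 0≤1+h k
      0≤ηw = 0≤* 0≤η 0≤w
      regroup : ∀ a b c d → a * b * (c * d) ≡ a * c * d * b
      regroup = solve-∀ ring
      swap-^ : ((1ℚ + h) ^ d) ^ k ≡ Eh ^ d
      swap-^ = trans (^-assocʳ (1ℚ + h) d k) (trans (cong ((1ℚ + h) ^_) (ℕₚ.*-comm d k)) (sym (^-assocʳ (1ℚ + h) k d)))
      Er^k≤ : Er ^ k ≤ Ew ^ d * Eη
      Er^k≤ = begin
        Er ^ k                              ≤⟨ exp-^-≤ 0≤r (suc n) k-1 ⟩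
        exp< M (⟦ k ⟧ * r)                  ≡⟨ cong (exp< M) (trans kr≡ (*-distribʳ-+ w ⟦ d ⟧ η)) ⟩
        exp< M (⟦ d ⟧ * w + η * w)          ≤⟨ exp-+-≤ (0≤* (0≤⟦⟧ d) 0≤w) 0≤ηw M ⟩
        exp< M (⟦ d ⟧ * w) * Eη             ≤⟨ *-monoˡ (0≤exp 0≤ηw M) (exp-⟦⟧*-≤ 0≤w (n ℕ.+ k-1 ℕ.* suc n) d) ⟩
        Ew ^ d * Eη                         ∎
      ηw≤1 : η * w ≤ 1ℚ
      ηw≤1 = *-mono 0≤η 0≤1 η≤1 (≤-trans w≤½ ½≤1)
      halve : ∀ η → 2ℚ * (η * ½) ≡ η
      halve = solve-∀ ring
      Eη≤ : Eη ≤ 1ℚ + η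
      Eη≤ = begin
        Eη                        ≤⟨ exp-monoˡ 0≤ηw (ℕₚ.m≤n+m M 2) ⟩
        exp< (2 ℕ.+ M) (η * w)    ≤⟨ exp≤1+2s 0≤ηw ηw≤1 M ⟩
        1ℚ + 2ℚ * (η * w)         ≤⟨ +-monoʳ-≤ 1ℚ (*-monoʳ (0≤⟦⟧ 2) (*-monoʳ 0≤η w≤½)) ⟩
        1ℚ + 2ℚ * (η * ½)         ≡⟨ cong (λ x → 1ℚ + x) (halve η) ⟩
        1ℚ + η                    ∎

    -- By `z x = c` the factor `c` is traded for `x`, which the logarithm turns into an exponential:
    -- `(x-η) Q ≤ exp r * Q ≤ 1 + η`. The remainder `η Q` is at most `4η`, and together these make
    -- up the 5.
    tail-bound : ∀ {x l η} → 0ℚ < z → z * x ≡ c → 0ℚ ≤ η → η ≤ ½ → ∀ {d j} → d ℕ.≤ j ℕ.* k →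
      ⟦ k ⟧ * l ≤ (⟦ d ⟧ + η) * w → ∀ i → x - η ≤ exp< (suc i ℕ.+ suc i) l →
      c * ((1ℚ + h) ^ d * c ^ j) ≤ z + ⟦ 5 ⟧ * η
    tail-bound {x} {l} {η} 0<z zx≡c 0≤η η≤½ {d} {j} d≤jk kl≤ i x-η≤ = begin
      c * Q                               ≡⟨ cong (_* Q) zx≡c ⟨
      z * x * Q                           ≡⟨ split z x η Q ⟩
      z * ((x - η) * Q + η * Q)           ≤⟨ *-monoʳ 0≤z (+-mono-≤ [x-η]Q≤1+η (*-monoʳ 0≤η Q≤4)) ⟩
      z * (1ℚ + η + η * ⟦ 4 ⟧)            ≡⟨ collect z η ⟩
      z + z * (⟦ 5 ⟧ * η)                 ≤⟨ +-monoʳ-≤ z (*-monoˡ (0≤* (0≤⟦⟧ 5) 0≤η) z≤1) ⟩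
      z + 1ℚ * (⟦ 5 ⟧ * η)                ≡⟨ cong (λ x → z + x) (*-identityˡ (⟦ 5 ⟧ * η)) ⟩
      z + ⟦ 5 ⟧ * η                       ∎
      where
      Q = (1ℚ + h) ^ d * c ^ j
      0≤Q : 0ℚ ≤ Q
      0≤Q = 0≤* (0≤^ 0≤1+h d) (0≤^ 0≤c j)
      z≤1 = ≤-trans z≤½ ½≤1
      split : ∀ z x η Q → z * x * Q ≡ z * ((x - η) * Q + η * Q)
      split = solve-∀ ring
      collect : ∀ z η → z * (1ℚ + η + η * ⟦ 4 ⟧) ≡ z + z * (⟦ 5 ⟧ * η)
      collect = solve-∀ ring
      ι = + 1 / k
      r = ι * ((⟦ d ⟧ + η) * w)
      0≤ι : 0ℚ ≤ ι
      0≤ι = nonNegative⁻¹ ι {{normalize-nonNeg 1 k}}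
      0≤r : 0ℚ ≤ r
      0≤r = 0≤* 0≤ι (0≤* (0≤+ (0≤⟦⟧ d) 0≤η) 0≤w)
      kr≡ : ⟦ k ⟧ * r ≡ (⟦ d ⟧ + η) * w
      kr≡ = trans (sym (*-assoc ⟦ k ⟧ ι _)) (trans (cong (_* ((⟦ d ⟧ + η) * w)) (⟦n⟧*1/n≡1 k)) (*-identityˡ _))
      l≤r : l ≤ r
      l≤r = *-cancelˡ-≤ (0<⟦⟧ k) (≤-trans kl≤ (≤-reflexive (sym kr≡)))
      neg-involutive : ∀ l → - (- l) ≡ l
      neg-involutive = solve-∀ ring
      -- If `l` is negative, the even truncation is at most 1, which lies below every nonempty
      -- truncation at `r ≥ 0`.
      exp-l≤exp-r : exp< (suc i ℕ.+ suc i) l ≤ exp< (suc i ℕ.+ suc i) r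
      exp-l≤exp-r with ≤-total 0ℚ l
      ... | inj₁ 0≤l = exp-mono 0≤l l≤r (suc i ℕ.+ suc i)
      ... | inj₂ l≤0 = ≤-trans
        (subst (λ y → exp< (suc i ℕ.+ suc i) y ≤ 1ℚ) (neg-involutive l) (exp-neg≤1 (neg-antimono-≤ l≤0) i))
        (1≤exp 0≤r (i ℕ.+ suc i))
      [x-η]Q≤1+η : (x - η) * Q ≤ 1ℚ + η
      [x-η]Q≤1+η = ≤-trans (*-monoˡ 0≤Q (≤-trans x-η≤ exp-l≤exp-r))
        (exp-tail 0≤r 0≤η (≤-trans η≤½ ½≤1) {d} {j} d≤jk kr≡ (i ℕ.+ suc i))
      1≤x : 1ℚ ≤ x
      1≤x = *-cancelˡ-≤ 0<z (≤-trans (≤-trans (≤-reflexive (*-identityʳ z)) (≤-trans z≤½ ½≤c)) (≤-reflexive (sym zx≡c)))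
      ½≤x-η : ½ ≤ x - η
      ½≤x-η = +-mono-≤ 1≤x (neg-antimono-≤ η≤½)
      -- From `½ Q ≤ (x-η) Q ≤ 1 + η ≤ 2`.
      Q≤4 : Q ≤ ⟦ 4 ⟧
      Q≤4 = *-cancelˡ-≤ (positive⁻¹ ½) (≤-trans (*-monoˡ 0≤Q ½≤x-η)
        (≤-trans [x-η]Q≤1+η (+-monoʳ-≤ 1ℚ (≤-trans η≤½ ½≤1))))

  -- Random subsets

  ind : Bool → ℚ
  ind true  = 1ℚ
  ind false = 0ℚ

  ∑ᶠ : ∀ {n} → (Fin n → ℚ) → ℚ
  ∑ᶠ {zero}  f = 0ℚ
  ∑ᶠ {suc n} f = f zero + ∑ᶠ (f ∘ suc)

  ∑ᶠ-cong : ∀ {n} {f g : Fin n → ℚ} → (∀ v → f v ≡ g v) → ∑ᶠ f ≡ ∑ᶠ g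
  ∑ᶠ-cong {zero}  f≡g = refl
  ∑ᶠ-cong {suc n} f≡g = cong₂ _+_ (f≡g zero) (∑ᶠ-cong (f≡g ∘ suc))

  ∑ᶠ-mono : ∀ {n} {f g : Fin n → ℚ} → (∀ v → f v ≤ g v) → ∑ᶠ f ≤ ∑ᶠ g
  ∑ᶠ-mono {zero}  f≤g = ≤-refl
  ∑ᶠ-mono {suc n} f≤g = +-mono-≤ (f≤g zero) (∑ᶠ-mono (f≤g ∘ suc))

  ∑ᶠ-const : ∀ n a → ∑ᶠ {n} (λ _ → a) ≡ ⟦ n ⟧ * a
  ∑ᶠ-const zero    a = sym (*-zeroˡ a)
  ∑ᶠ-const (suc n) a = trans (cong (λ x → a + x) (∑ᶠ-const n a))
    (trans (distrib a ⟦ n ⟧) (cong (_* a) (sym (⟦⟧-suc n))))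
    where
    distrib : ∀ a x → a + x * a ≡ (1ℚ + x) * a
    distrib = solve-∀ ring

  ∣tabulate∣ : ∀ {n} (f : Fin n → Bool) → ⟦ ∣ tabulate f ∣ ⟧ ≡ ∑ᶠ (ind ∘ f)
  ∣tabulate∣ {zero}  f = refl
  ∣tabulate∣ {suc n} f with f zero
  ... | true  = trans (⟦⟧-suc ∣ tabulate (f ∘ suc) ∣) (cong (λ x → 1ℚ + x) (∣tabulate∣ (f ∘ suc)))
  ... | false = trans (∣tabulate∣ (f ∘ suc)) (sym (+-identityˡ (∑ᶠ (ind ∘ f ∘ suc))))

  module RandomSubset (p : ℚ) where

    -- Expectation over a set containing each vertex independently with probability `p`.
    -- Conditioning on one vertex at a time makes the identities below inductions instead of
    -- manipulations of a sum over all subsets.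
    𝔼 : ∀ {n} → (Subset n → ℚ) → ℚ
    𝔼 {zero}  f = f []
    𝔼 {suc n} f = p * 𝔼 (f ∘ (inside ∷_)) + (1ℚ - p) * 𝔼 (f ∘ (outside ∷_))

    𝔼-cong : ∀ {n} {f g : Subset n → ℚ} → (∀ S → f S ≡ g S) → 𝔼 f ≡ 𝔼 g
    𝔼-cong {zero}  f≡g = f≡g []
    𝔼-cong {suc n} f≡g = cong₂ (λ x y → p * x + (1ℚ - p) * y)
      (𝔼-cong (f≡g ∘ (inside ∷_))) (𝔼-cong (f≡g ∘ (outside ∷_)))

    𝔼-mono : 0ℚ ≤ p → p ≤ 1ℚ → ∀ {n} {f g : Subset n → ℚ} → (∀ S → f S ≤ g S) → 𝔼 f ≤ 𝔼 g
    𝔼-mono 0≤p p≤1 {zero}  f≤g = f≤g []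
    𝔼-mono 0≤p p≤1 {suc n} f≤g = +-mono-≤
      (*-monoʳ 0≤p (𝔼-mono 0≤p p≤1 (f≤g ∘ (inside ∷_))))
      (*-monoʳ (p≤q⇒0≤q-p p≤1) (𝔼-mono 0≤p p≤1 (f≤g ∘ (outside ∷_))))

    𝔼-const : ∀ n a → 𝔼 {n} (λ _ → a) ≡ a
    𝔼-const zero    a = refl
    𝔼-const (suc n) a = trans (cong₂ (λ x y → p * x + (1ℚ - p) * y) (𝔼-const n a) (𝔼-const n a)) (mix p a)
      where
      mix : ∀ p a → p * a + (1ℚ - p) * a ≡ a
      mix = solve-∀ ring

    𝔼-+ : ∀ {n} (f g : Subset n → ℚ) → 𝔼 (λ S → f S + g S) ≡ 𝔼 f + 𝔼 g
    𝔼-+ {zero}  f g = refl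
    𝔼-+ {suc n} f g = trans
      (cong₂ (λ x y → p * x + (1ℚ - p) * y)
        (𝔼-+ (f ∘ (inside ∷_)) (g ∘ (inside ∷_))) (𝔼-+ (f ∘ (outside ∷_)) (g ∘ (outside ∷_))))
      (interchange p (1ℚ - p) (𝔼 (f ∘ (inside ∷_))) (𝔼 (g ∘ (inside ∷_))) (𝔼 (f ∘ (outside ∷_))) (𝔼 (g ∘ (outside ∷_))))
      where
      interchange : ∀ p q a b c d → p * (a + b) + q * (c + d) ≡ (p * a + q * c) + (p * b + q * d)
      interchange = solve-∀ ring

    𝔼-* : ∀ {n} a (f : Subset n → ℚ) → 𝔼 (λ S → a * f S) ≡ a * 𝔼 f
    𝔼-* {zero}  a f = refl
    𝔼-* {suc n} a f = trans
      (cong₂ (λ x y → p * x + (1ℚ - p) * y) (𝔼-* a (f ∘ (inside ∷_))) (𝔼-* a (f ∘ (outside ∷_))))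
      (pull p (1ℚ - p) a (𝔼 (f ∘ (inside ∷_))) (𝔼 (f ∘ (outside ∷_))))
      where
      pull : ∀ p q a x y → p * (a * x) + q * (a * y) ≡ a * (p * x + q * y)
      pull = solve-∀ ring

    𝔼-∑ : ∀ {m n} (f : Fin m → Subset n → ℚ) → 𝔼 (λ S → ∑ᶠ (λ v → f v S)) ≡ ∑ᶠ (λ v → 𝔼 (f v))
    𝔼-∑ {zero}  {n} f = 𝔼-const n 0ℚ
    𝔼-∑ {suc m} f = trans (𝔼-+ (f zero) (λ S → ∑ᶠ (λ v → f (suc v) S))) (cong (λ x → 𝔼 (f zero) + x) (𝔼-∑ (f ∘ suc)))

    𝔼-ind : ∀ {n} (v : Fin n) → 𝔼 (λ S → ind (lookup S v)) ≡ p
    𝔼-ind {suc n} zero = trans (cong₂ (λ x y → p * x + (1ℚ - p) * y) (𝔼-const n 1ℚ) (𝔼-const n 0ℚ)) (select p)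
      where
      select : ∀ p → p * 1ℚ + (1ℚ - p) * 0ℚ ≡ p
      select = solve-∀ ring
    𝔼-ind {suc n} (suc v) = trans (cong₂ (λ x y → p * x + (1ℚ - p) * y) (𝔼-ind v) (𝔼-ind v)) (mix p)
      where
      mix : ∀ p → p * p + (1ℚ - p) * p ≡ p
      mix = solve-∀ ring

    module _ (t : ℚ) where

      -- Equal to `(1-p) + p t`, the generating function of a single vertex.
      μ : ℚ
      μ = 1ℚ + p * (t - 1ℚ)

      private
        step-in : ∀ p t x → p * (t * x) + (1ℚ - p) * x ≡ (1ℚ + p * (t - 1ℚ)) * x
        step-in = solve-∀ ring
        step-out : ∀ p x → p * x + (1ℚ - p) * x ≡ x
        step-out = solve-∀ ring

      𝔼-pow : ∀ {n} (N : Subset n) → 𝔼 (λ S → t ^ ∣ N ∩ S ∣) ≡ μ ^ ∣ N ∣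
      𝔼-pow []            = refl
      𝔼-pow (inside ∷ N)  = trans
        (cong₂ (λ x y → p * x + (1ℚ - p) * y)
          (trans (𝔼-* t (λ S → t ^ ∣ N ∩ S ∣)) (cong (t *_) (𝔼-pow N))) (𝔼-pow N))
        (step-in p t (μ ^ ∣ N ∣))
      𝔼-pow (outside ∷ N) = trans
        (cong₂ (λ x y → p * x + (1ℚ - p) * y) (𝔼-pow N) (𝔼-pow N)) (step-out p (μ ^ ∣ N ∣))

      -- As `v` lies outside `N`, its membership is independent of the exponent: coordinate `v`
      -- yields `p` and each coordinate of `N` yields `μ`.
      𝔼-ind-pow : ∀ {n} (v : Fin n) (N : Subset n) → lookup N v ≡ outside →
        𝔼 (λ S → ind (lookup S v) * t ^ ∣ N ∩ S ∣) ≡ p * μ ^ ∣ N ∣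
      𝔼-ind-pow {suc n} zero (outside ∷ N) refl = trans
        (cong₂ (λ x y → p * x + (1ℚ - p) * y)
          (trans (𝔼-* 1ℚ (λ S → t ^ ∣ N ∩ S ∣)) (cong (1ℚ *_) (𝔼-pow N)))
          (𝔼-* 0ℚ (λ S → t ^ ∣ N ∩ S ∣)))
        (select p (μ ^ ∣ N ∣) (𝔼 (λ S → t ^ ∣ N ∩ S ∣)))
        where
        select : ∀ p x y → p * (1ℚ * x) + (1ℚ - p) * (0ℚ * y) ≡ p * x
        select = solve-∀ ring
      𝔼-ind-pow (suc v) (inside ∷ N) v∉N = trans
        (cong₂ (λ x y → p * x + (1ℚ - p) * y)
          (trans (𝔼-cong (λ S → pull (ind (lookup S v)) t (t ^ ∣ N ∩ S ∣)))
            (trans (𝔼-* t (λ S → ind (lookup S v) * t ^ ∣ N ∩ S ∣)) (cong (t *_) (𝔼-ind-pow v N v∉N))))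
          (𝔼-ind-pow v N v∉N))
        (trans (step-in p t (p * μ ^ ∣ N ∣)) (pull μ p (μ ^ ∣ N ∣)))
        where
        pull : ∀ i t x → i * (t * x) ≡ t * (i * x)
        pull = solve-∀ ring
      𝔼-ind-pow (suc v) (outside ∷ N) v∉N = trans
        (cong₂ (λ x y → p * x + (1ℚ - p) * y) (𝔼-ind-pow v N v∉N) (𝔼-ind-pow v N v∉N))
        (step-out p (p * μ ^ ∣ N ∣))

      -- Deleting the bad vertices of a random set: no outcome exceeds M, hence neither does the mean.
      alteration : 0ℚ ≤ p → p ≤ 1ℚ → ∀ {n} (N : Fin n → Subset n) → (∀ v → lookup (N v) v ≡ outside) →
        (good : Fin n → Subset n → Bool) (b : Fin n → ℚ) →
        (∀ v S → 1ℚ - b v * t ^ ∣ N v ∩ S ∣ ≤ ind (good v S)) →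
        (M : ℕ) → (∀ S → ∣ tabulate (λ v → lookup S v ∧ good v S) ∣ ℕ.≤ M) →
        ∑ᶠ (λ v → p - b v * (p * μ ^ ∣ N v ∣)) ≤ ⟦ M ⟧
      alteration 0≤p p≤1 {n} N v∉Nv good b bound M ∣U∣≤M = begin
        ∑ᶠ (λ v → p - b v * (p * μ ^ ∣ N v ∣))      ≡⟨ ∑ᶠ-cong mean ⟨
        ∑ᶠ (λ v → 𝔼 (lower v))                      ≡⟨ 𝔼-∑ lower ⟨
        𝔼 (λ S → ∑ᶠ (λ v → lower v S))              ≤⟨ 𝔼-mono 0≤p p≤1 (λ S → ≤-trans (∑ᶠ-mono (λ v → pointwise v S))
                                                         (≤-reflexive (sym (∣tabulate∣ (λ v → lookup S v ∧ good v S))))) ⟩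
        𝔼 (λ S → ⟦ ∣ tabulate (λ v → lookup S v ∧ good v S) ∣ ⟧)
                                                    ≤⟨ 𝔼-mono 0≤p p≤1 (λ S → ⟦⟧-mono (∣U∣≤M S)) ⟩
        𝔼 {n} (λ S → ⟦ M ⟧)                         ≡⟨ 𝔼-const n ⟦ M ⟧ ⟩
        ⟦ M ⟧                                       ∎
        where
        open ≤-Reasoning
        -- Markov's inequality applied before averaging: `b v * t ^ X` is at least 1 when `v` is
        -- bad, so `lower` stays below the indicator of survival, and its mean involves only the
        -- generating function.
        lower : Fin n → Subset n → ℚ
        lower v S = ind (lookup S v) + - b v * (ind (lookup S v) * t ^ ∣ N v ∩ S ∣)
        minus : ∀ p b x → p + - b * x ≡ p - b * x
        minus = solve-∀ ring
        mean : ∀ v → 𝔼 (lower v) ≡ p - b v * (p * μ ^ ∣ N v ∣)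
        mean v = trans (𝔼-+ (λ S → ind (lookup S v)) (λ S → - b v * (ind (lookup S v) * t ^ ∣ N v ∩ S ∣)))
          (trans (cong₂ _+_ (𝔼-ind v) (trans (𝔼-* (- b v) (λ S → ind (lookup S v) * t ^ ∣ N v ∩ S ∣))
              (cong (- b v *_) (𝔼-ind-pow v (N v) (v∉Nv v)))))
            (minus p (b v) (p * μ ^ ∣ N v ∣)))
        on : ∀ b x → 1ℚ + - b * (1ℚ * x) ≡ 1ℚ - b * x
        on = solve-∀ ring
        off : ∀ b x → 0ℚ + - b * (0ℚ * x) ≡ 0ℚ
        off = solve-∀ ring
        pointwise : ∀ v S → lower v S ≤ ind (lookup S v ∧ good v S)
        pointwise v S with lookup S v
        ... | true  = ≤-trans (≤-reflexive (on (b v) (t ^ ∣ N v ∩ S ∣))) (bound v S)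
        ... | false = ≤-reflexive (off (b v) (t ^ ∣ N v ∩ S ∣))

  -- Sparse sets of a digraph

  -- The bound on the size descends from `n`: either it is attained, or no set has that size and it
  -- drops by one. At 0 the empty set is a maximum.
  maximum-subset : ∀ {n} {P : Subset n → Set} → Decidable P → P ⊥ →
    ∃[ T ] (P T × (∀ S → P S → ∣ S ∣ ℕ.≤ ∣ T ∣))
  maximum-subset {n} {P} P? P⊥ = go n (λ S _ → ∣p∣≤n S)
    where
    go : ∀ m → (∀ S → P S → ∣ S ∣ ℕ.≤ m) → ∃[ T ] (P T × (∀ S → P S → ∣ S ∣ ℕ.≤ ∣ T ∣))
    go zero    ≤0 = ⊥ , P⊥ , λ S PS → ℕₚ.≤-trans (≤0 S PS) z≤n
    go (suc m) ≤m with anySubset? (λ S → P? S ×-dec (∣ S ∣ ℕₚ.≟ suc m))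
    ... | yes (T , PT , ∣T∣≡m) = T , PT , λ S PS → subst (∣ S ∣ ℕ.≤_) (sym ∣T∣≡m) (≤m S PS)
    ... | no  ∄T = go m (λ S PS → ℕₚ.≤-pred (ℕₚ.≤∧≢⇒< (≤m S PS) (λ eq → ∄T (S , PS , eq))))

  does-true : ∀ {A : Set} (a? : Dec A) → does a? ≡ true → A
  does-true (yes a) refl = a

  ≤-ind : ∀ {A : Set} (a? : Dec A) {x} → (A → x ≤ 1ℚ) → (¬ A → x ≤ 0ℚ) → x ≤ ind (does a?)
  ≤-ind (yes a) x≤1 x≤0 = x≤1 a
  ≤-ind (no ¬a) x≤1 x≤0 = x≤0 ¬a

  ∧-true : ∀ x {y} → x ∧ y ≡ true → x ≡ true × y ≡ true
  ∧-true true eq = refl , eq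

  module _ {n : ℕ} (G : Digraph n) (k-1 : ℕ) where

    open Digraph G

    private
      k = suc k-1

    Sparse : Subset n → Set
    Sparse S = ∀ v → v ∈ S → k ℕ.* ∣ N⁺ v ∩ S ∣ ℕ.≤ deg⁺ v

    sparse? : Decidable Sparse
    sparse? S = all? (λ v → (v ∈? S) →-dec (k ℕ.* ∣ N⁺ v ∩ S ∣ ℕₚ.≤? deg⁺ v))

    good : Fin n → Subset n → Bool
    good v S = does (k ℕ.* ∣ N⁺ v ∩ S ∣ ℕₚ.≤? deg⁺ v)

    prune : Subset n → Subset n
    prune S = tabulate (λ v → lookup S v ∧ good v S)

    ∈-prune⁻ : ∀ S {v} → v ∈ prune S → v ∈ S × k ℕ.* ∣ N⁺ v ∩ S ∣ ℕ.≤ deg⁺ v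
    ∈-prune⁻ S {v} v∈ =
      let (v∈S , v-good) = ∧-true (lookup S v) (trans (sym (lookup∘tabulate _ v)) ([]=⇒lookup v∈))
      in lookup⇒[]= v S v∈S , does-true (k ℕ.* ∣ N⁺ v ∩ S ∣ ℕₚ.≤? deg⁺ v) v-good

    -- One round of deletion suffices: the threshold `deg⁺ v` is taken in the whole digraph, while
    -- deletions only shrink the set of out-neighbours that remain.
    prune-sparse : ∀ S → Sparse (prune S)
    prune-sparse S v v∈ = ℕₚ.≤-trans (ℕₚ.*-monoʳ-≤ k (p⊆q⇒∣p∣≤∣q∣ N∩prune⊆N∩S)) (proj₂ (∈-prune⁻ S v∈))
      where
      N∩prune⊆N∩S : N⁺ v ∩ prune S ⊆ N⁺ v ∩ S
      N∩prune⊆N∩S u∈ =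
        let (u∈N , u∈U) = x∈p∩q⁻ (N⁺ v) (prune S) u∈
        in x∈p∩q⁺ (u∈N , proj₁ (∈-prune⁻ S u∈U))

    private
      ι = recip ⟦ k ⟧

      kι≡1 : ⟦ k ⟧ * ι ≡ 1ℚ
      kι≡1 = recip-inverse (0<⟦⟧ k)

      0≤ι : 0ℚ ≤ ι
      0≤ι = <⇒≤ (0<recip (0<⟦⟧ k))

      ι≤1 : ι ≤ 1ℚ
      ι≤1 = subst₂ _≤_ (*-identityˡ ι) kι≡1 (*-monoˡ 0≤ι (⟦⟧-mono {1} {k} (s≤s z≤n)))

    -- The rationals e and l stand for ε and the logarithm, with the hypotheses holding up to an error η.
    sparse-bound : ∀ {e l η} → 0ℚ < e → e ≤ ι → 0ℚ ≤ η → η ≤ ½ →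
      ∀ i → (⟦ 2 ⟧ * recip (e * ⟦ k ⟧) - 1ℚ) - η ≤ exp< (suc i ℕ.+ suc i) l →
      (∀ v → ⟦ 2 ⟧ * recip (e * (e * 1ℚ)) * (⟦ 4 ⟧ * ι - e) * l ≤ ⟦ deg⁺ v ⟧ + η) →
      ∀ M → (∀ S → Sparse S → ∣ S ∣ ℕ.≤ M) → ⟦ n ⟧ * (ι - e - ⟦ 5 ⟧ * η) ≤ ⟦ M ⟧
    sparse-bound {e} {l} {η} 0<e e≤ι 0≤η η≤½ i x-η≤exp degree M maximal = begin
      ⟦ n ⟧ * (ι - e - ⟦ 5 ⟧ * η)                  ≡⟨ ∑ᶠ-const n (ι - e - ⟦ 5 ⟧ * η) ⟨
      ∑ᶠ {n} (λ v → ι - e - ⟦ 5 ⟧ * η)             ≤⟨ ∑ᶠ-mono term ⟩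
      ∑ᶠ (λ v → p - c ^ j v * (p * (1ℚ + h) ^ deg⁺ v))
                                                   ≡⟨ cong (λ x → ∑ᶠ (λ v → p - c ^ j v * (p * x ^ deg⁺ v))) μ≡1+h ⟨
      ∑ᶠ (λ v → p - c ^ j v * (p * μ t ^ deg⁺ v))  ≤⟨ alteration t 0≤p p≤1 N⁺ (λ v → trans (lookup∘tabulate (arc v) v) (loopless v))
                                                        good (λ v → c ^ j v) indicator M (λ S → maximal (prune S) (prune-sparse S)) ⟩
      ⟦ M ⟧                                        ∎
      where
      open ≤-Reasoning
      -- Half of `e` is spent on lowering `p` to `ι - h`, the other half on the discarded vertices.
      h = ½ * e
      z = ⟦ k ⟧ * h
      0<h : 0ℚ < h
      0<h = 0<* (positive⁻¹ ½) 0<e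
      0<z : 0ℚ < z
      0<z = 0<* (0<⟦⟧ k) 0<h
      z≤½ : z ≤ ½
      z≤½ = begin
        ⟦ k ⟧ * (½ * e)      ≤⟨ *-monoʳ (0≤⟦⟧ k) (*-monoʳ (nonNegative⁻¹ ½) e≤ι) ⟩
        ⟦ k ⟧ * (½ * ι)      ≡⟨ swap ⟦ k ⟧ ι ⟩
        ½ * (⟦ k ⟧ * ι)      ≡⟨ cong (½ *_) kι≡1 ⟩
        ½ * 1ℚ               ≡⟨ *-identityʳ ½ ⟩
        ½                    ∎
        where
        swap : ∀ κ ι → κ * (½ * ι) ≡ ½ * (κ * ι)
        swap = solve-∀ ring
      0<2-z : 0ℚ < 2ℚ - z
      0<2-z = p<q⇒0<q-p {z} {2ℚ} (≤-<-trans z≤½ (*<* (ℤ.+<+ (s≤s (s≤s z≤n)))))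
      I = recip (2ℚ - z)
      [2-z]I≡1 : (2ℚ - z) * I ≡ 1ℚ
      [2-z]I≡1 = recip-inverse 0<2-z
      -- Here `w / k` is `e² / (2 (4/k - e))`, the reciprocal of the factor before the logarithm;
      -- multiplying the degree condition by `w` therefore leaves `k l` on its left.
      w = z * z * I
      0≤w : 0ℚ ≤ w
      0≤w = 0≤* (0≤* (<⇒≤ 0<z) (<⇒≤ 0<z)) (<⇒≤ (0<recip 0<2-z))
      [2-z]w≡z² : (2ℚ - z) * w ≡ z * z
      [2-z]w≡z² = trans (pull (2ℚ - z) (z * z) I) (trans (cong (z * z *_) [2-z]I≡1) (*-identityʳ (z * z)))
        where
        pull : ∀ a b c → a * (b * c) ≡ b * (a * c)
        pull = solve-∀ ring
      open Chernoff k-1 {h} {z} {w} (<⇒≤ 0<h) refl z≤½ 0≤w [2-z]w≡z² using (c; ½≤c; 0≤c; c≤1; tail-bound)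
      0<c : 0ℚ < c
      0<c = <-≤-trans (positive⁻¹ ½) ½≤c
      -- The tilt with `p t = 1/k`, whence `μ t = 1 + (1/k - p) = 1 + h`.
      t = recip c
      ct≡1 : c * t ≡ 1ℚ
      ct≡1 = recip-inverse 0<c
      0≤t : 0ℚ ≤ t
      0≤t = <⇒≤ (0<recip 0<c)
      p = ι * c
      0≤p : 0ℚ ≤ p
      0≤p = 0≤* 0≤ι 0≤c
      p≤1 : p ≤ 1ℚ
      p≤1 = *-mono 0≤ι 0≤1 ι≤1 c≤1
      ιz≡h : ι * z ≡ h
      ιz≡h = trans (rotate ι ⟦ k ⟧ h) (trans (cong (_* h) kι≡1) (*-identityˡ h))
        where
        rotate : ∀ ι κ h → ι * (κ * h) ≡ κ * ι * h
        rotate = solve-∀ ring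
      open RandomSubset p using (μ; alteration)
      μ≡1+h : μ t ≡ 1ℚ + h
      μ≡1+h = trans (expand ι z t) (trans (cong₂ (λ x y → 1ℚ + y + ι * (x - 1ℚ)) ct≡1 ιz≡h) (cancel h ι))
        where
        expand : ∀ ι z t → 1ℚ + ι * (1ℚ - z) * (t - 1ℚ) ≡ 1ℚ + ι * z + ι * ((1ℚ - z) * t - 1ℚ)
        expand = solve-∀ ring
        cancel : ∀ h ι → 1ℚ + h + ι * (1ℚ - 1ℚ) ≡ 1ℚ + h
        cancel = solve-∀ ring
      j : Fin n → ℕ
      -- The least integer above `deg⁺ v / k`: every bad vertex has at least `j v` out-neighbours in
      -- the random set, and `j v * k` still dominates the degree.
      j v = suc (deg⁺ v ℕ./ k)
      deg≤j*k : ∀ v → deg⁺ v ℕ.≤ j v ℕ.* k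
      deg≤j*k v = subst (ℕ._≤ j v ℕ.* k) (sym (ℕ.m≡m%n+[m/n]*n (deg⁺ v) k))
        (ℕₚ.+-monoˡ-≤ (deg⁺ v ℕ./ k ℕ.* k) (ℕₚ.<⇒≤ (ℕ.m%n<n (deg⁺ v) k)))
      indicator : ∀ v S → 1ℚ - c ^ j v * t ^ ∣ N⁺ v ∩ S ∣ ≤ ind (good v S)
      indicator v S = ≤-ind (k ℕ.* m ℕₚ.≤? deg⁺ v)
        (λ _ → +-monoʳ-≤ 1ℚ (neg-antimono-≤ (0≤* (0≤^ 0≤c (j v)) (0≤^ 0≤t m))))
        (λ km≰d → +-monoʳ-≤ 1ℚ (neg-antimono-≤ (1≤cʲtᵐ km≰d)))
        where
        m = ∣ N⁺ v ∩ S ∣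
        j≤m : ¬ (k ℕ.* m ℕ.≤ deg⁺ v) → j v ℕ.≤ m
        j≤m km≰d = ℕ.m<n*o⇒m/o<n (subst (deg⁺ v ℕ.<_) (ℕₚ.*-comm k m) (ℕₚ.≰⇒> km≰d))
        1≤cʲtᵐ : ¬ (k ℕ.* m ℕ.≤ deg⁺ v) → 1ℚ ≤ c ^ j v * t ^ m
        1≤cʲtᵐ km≰d = begin
          1ℚ                  ≡⟨ 1^n≡1 m ⟨
          1ℚ ^ m              ≡⟨ cong (_^ m) ct≡1 ⟨
          (c * t) ^ m         ≡⟨ ^-distrib-* c t m ⟩
          c ^ m * t ^ m       ≤⟨ *-monoˡ (0≤^ 0≤t m) (^-antimonoʳ 0≤c c≤1 (j≤m km≰d)) ⟩
          c ^ j v * t ^ m     ∎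
      x = ⟦ 2 ⟧ * recip (e * ⟦ k ⟧) - 1ℚ
      -- The argument of the logarithm is `1/z - 1`.
      zx≡c : z * x ≡ c
      zx≡c = trans (expand ⟦ k ⟧ e (recip (e * ⟦ k ⟧))) (cong (_- z) (recip-inverse (0<* 0<e (0<⟦⟧ k))))
        where
        expand : ∀ κ e r → κ * (½ * e) * (2ℚ * r - 1ℚ) ≡ e * κ * r - κ * (½ * e)
        expand = solve-∀ ring
      kl≤ : ∀ v → ⟦ k ⟧ * l ≤ (⟦ deg⁺ v ⟧ + η) * w
      kl≤ v = subst (_≤ (⟦ deg⁺ v ⟧ + η) * w) Cwl≡kl (*-monoˡ 0≤w (degree v))
        where
        R = recip (e * (e * 1ℚ))
        expand : ∀ κ ι e R I l → 2ℚ * R * (⟦ 4 ⟧ * ι - e) * l * (κ * (½ * e) * (κ * (½ * e)) * I)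
          ≡ e * (e * 1ℚ) * R * κ * l * ((2ℚ * (κ * ι) - κ * (½ * e)) * I)
        expand = solve-∀ ring
        finish : ∀ κ l → 1ℚ * κ * l * 1ℚ ≡ κ * l
        finish = solve-∀ ring
        Cwl≡kl : 2ℚ * R * (⟦ 4 ⟧ * ι - e) * l * w ≡ ⟦ k ⟧ * l
        Cwl≡kl = trans (expand ⟦ k ⟧ ι e R I l) (trans
          (cong₂ (λ x y → x * ⟦ k ⟧ * l * y)
            (recip-inverse (0<* 0<e (0<* 0<e (positive⁻¹ 1ℚ))))
            (trans (cong (λ x → (x - z) * I) (trans (cong (2ℚ *_) kι≡1) (*-identityʳ 2ℚ))) [2-z]I≡1))
          (finish ⟦ k ⟧ l))
      term : ∀ v → ι - e - ⟦ 5 ⟧ * η ≤ p - c ^ j v * (p * (1ℚ + h) ^ deg⁺ v)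
      term v = begin
        ι - e - ⟦ 5 ⟧ * η                                     ≡⟨ halves ι e (⟦ 5 ⟧ * η) ⟩
        ι - h - (h + ⟦ 5 ⟧ * η)                               ≡⟨ cong (λ x → ι - x - (h + ⟦ 5 ⟧ * η)) ιz≡h ⟨
        ι - ι * z - (h + ⟦ 5 ⟧ * η)                           ≡⟨ cong (_- (h + ⟦ 5 ⟧ * η)) (factor ι z) ⟩
        p - (h + ⟦ 5 ⟧ * η)                                   ≤⟨ +-monoʳ-≤ p (neg-antimono-≤ tail≤) ⟩
        p - c ^ j v * (p * (1ℚ + h) ^ deg⁺ v)                 ∎
        where
        halves : ∀ ι e x → ι - e - x ≡ ι - ½ * e - (½ * e + x)
        halves = solve-∀ ring
        factor : ∀ ι z → ι - ι * z ≡ ι * (1ℚ - z)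
        factor = solve-∀ ring
        shuffle : ∀ a ι c b → a * (ι * c * b) ≡ ι * (c * (b * a))
        shuffle = solve-∀ ring
        tail≤ : c ^ j v * (p * (1ℚ + h) ^ deg⁺ v) ≤ h + ⟦ 5 ⟧ * η
        tail≤ = begin
          c ^ j v * (p * (1ℚ + h) ^ deg⁺ v)         ≡⟨ shuffle (c ^ j v) ι c ((1ℚ + h) ^ deg⁺ v) ⟩
          ι * (c * ((1ℚ + h) ^ deg⁺ v * c ^ j v))   ≤⟨ *-monoʳ 0≤ι (tail-bound {x} {l} 0<z zx≡c 0≤η η≤½ {deg⁺ v} {j v} (deg≤j*k v) (kl≤ v) i x-η≤exp) ⟩
          ι * (z + ⟦ 5 ⟧ * η)                       ≡⟨ trans (*-distribˡ-+ ι z (⟦ 5 ⟧ * η)) (cong (_+ ι * (⟦ 5 ⟧ * η)) ιz≡h) ⟩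
          h + ι * (⟦ 5 ⟧ * η)                       ≤⟨ +-monoʳ-≤ h (*-monoˡ (0≤* (0≤⟦⟧ 5) 0≤η) ι≤1) ⟩
          h + 1ℚ * (⟦ 5 ⟧ * η)                      ≡⟨ cong (λ x → h + x) (*-identityˡ (⟦ 5 ⟧ * η)) ⟩
          h + ⟦ 5 ⟧ * η                             ∎

  -- Passing from reals to their rational approximations

  -- Hypotheses on reals become statements about late terms of sequences. Finitely many of them
  -- share an index, and the rational argument runs at that index.
  Eventually : (ℕ → Set) → Set
  Eventually P = ∃[ N ] (∀ m → N ℕ.≤ m → P m)

  both : ∀ {P Q} → Eventually P → Eventually Q → Eventually (λ m → P m × Q m)
  both (M , p) (N , q) = M ℕ.⊔ N , λ m M⊔N≤m →
    p m (ℕₚ.≤-trans (ℕₚ.m≤m⊔n M N) M⊔N≤m) , q m (ℕₚ.≤-trans (ℕₚ.m≤n⊔m M N) M⊔N≤m)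

  every : ∀ {n} {P : Fin n → ℕ → Set} → (∀ v → Eventually (P v)) → Eventually (λ m → ∀ v → P v m)
  every {zero}  p = 0 , λ _ _ ()
  every {suc n} p =
    let (N , q) = both (p zero) (every (λ v → p (suc v)))
    in N , λ { m N≤m zero → let (a , _) = q m N≤m in a ; m N≤m (suc v) → let (_ , b) = q m N≤m in b v }

  p≤∣p∣ : ∀ p → p ≤ ℚ.∣ p ∣
  p≤∣p∣ p with ≤-total 0ℚ p
  ... | inj₁ 0≤p = ≤-reflexive (sym (0≤p⇒∣p∣≡p 0≤p))
  ... | inj₂ p≤0 = ≤-trans p≤0 (0≤∣p∣ p)

  0<⊓ : ∀ {p q} → 0ℚ < p → 0ℚ < q → 0ℚ < p ⊓ q
  0<⊓ {p} {q} 0<p 0<q with ⊓-sel p q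
  ... | inj₁ eq = subst (0ℚ <_) (sym eq) 0<p
  ... | inj₂ eq = subst (0ℚ <_) (sym eq) 0<q

  -- Take `N` beyond which terms differ by at most `δ/4`, and decide whether the term at `N` is at
  -- most `δ/2`. If it is, later terms stay below `δ`; if not, they stay above `δ/4`, which would
  -- make `y` positive.
  ¬positive⇒eventually≤ : ∀ {y} → ¬ Defs.Positive y → ∀ {δ} → 0ℚ < δ → Eventually (λ m → seq y m ≤ δ)
  ¬positive⇒eventually≤ {y} ¬pos {δ} 0<δ with cauchy y (½ * (½ * δ)) 0<θ
    where
    0<θ : 0ℚ < ½ * (½ * δ)
    0<θ = 0<* (positive⁻¹ ½) (0<* (positive⁻¹ ½) 0<δ)
  ... | N , near with seq y N ≤? ½ * δ
  ... | yes yN≤ = N , λ m N≤m → begin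
    seq y m                              ≡⟨ telescope (seq y m) (seq y N) ⟩
    seq y N + (seq y m - seq y N)        ≤⟨ +-mono-≤ yN≤ (≤-trans (p≤∣p∣ _) (near m N N≤m ℕₚ.≤-refl)) ⟩
    ½ * δ + ½ * (½ * δ)                  ≤⟨ p≤p+q (0≤* (nonNegative⁻¹ ½) (0≤* (nonNegative⁻¹ ½) (<⇒≤ 0<δ))) ⟩
    ½ * δ + ½ * (½ * δ) + ½ * (½ * δ)    ≡⟨ halves δ ⟩
    δ                                    ∎
    where
    open ≤-Reasoning
    telescope : ∀ a b → a ≡ b + (a - b)
    telescope = solve-∀ ring
    halves : ∀ δ → ½ * δ + ½ * (½ * δ) + ½ * (½ * δ) ≡ δ
    halves = solve-∀ ring
  ... | no yN≰ = contradiction (mkPositive (½ * (½ * δ)) (0<* (positive⁻¹ ½) (0<* (positive⁻¹ ½) 0<δ)) N λ m N≤m → begin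
    ½ * (½ * δ)                          ≡⟨ halves δ ⟩
    ½ * δ - ½ * (½ * δ)                  ≤⟨ +-mono-≤ (<⇒≤ (≰⇒> yN≰)) (neg-antimono-≤ (≤-trans (p≤∣p∣ _) (near N m ℕₚ.≤-refl N≤m))) ⟩
    seq y N - (seq y N - seq y m)        ≡⟨ telescope (seq y N) (seq y m) ⟩
    seq y m                              ∎) ¬pos
    where
    open ≤-Reasoning
    telescope : ∀ a b → a - (a - b) ≡ b
    telescope = solve-∀ ring
    halves : ∀ δ → ½ * (½ * δ) ≡ ½ * δ - ½ * (½ * δ)
    halves = solve-∀ ring

  seq-^ : ∀ x n m → seq (x Defs.^ n) m ≡ seq x m ^ n
  seq-^ x zero    m = refl
  seq-^ x (suc n) m = cong (seq x m *_) (seq-^ x n m)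

  seq-expSum : ∀ x n m → seq (expSum x n) m ≡ exp< n (seq x m)
  seq-expSum x zero    m = refl
  seq-expSum x (suc n) m = cong₂ _+_ (seq-expSum x n m) (cong (_* inv! n) (seq-^ x n m))

  -- All reals here are constant sequences, so a witness of the reverse strict inequality would be a
  -- positive rational that is at most 0.
  sparse⇒≤ : ∀ k .{{_ : ℕ.NonZero k}} {a d} → k ℕ.* a ℕ.≤ d → fromℕ a Defs.≤ fromℕ 1 Defs./ fromℕ k Defs.* fromℕ d
  sparse⇒≤ k {a} {d} ka≤d (mkPositive g 0<g N above) =
    <-irrefl refl (<-≤-trans 0<g (≤-trans (above N ℕₚ.≤-refl) (begin
      ⟦ a ⟧ - 1ℚ * ι * ⟦ d ⟧           ≤⟨ +-monoʳ-≤ ⟦ a ⟧ (neg-antimono-≤ a≤ιd) ⟩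
      ⟦ a ⟧ - ⟦ a ⟧                    ≡⟨ +-inverseʳ ⟦ a ⟧ ⟩
      0ℚ                               ∎)))
    where
    open ≤-Reasoning
    ι = recip ⟦ k ⟧
    rotate : ∀ κ ι a → κ * ι * a ≡ 1ℚ * ι * (κ * a)
    rotate = solve-∀ ring
    a≤ιd : ⟦ a ⟧ ≤ 1ℚ * ι * ⟦ d ⟧
    a≤ιd = begin
      ⟦ a ⟧                        ≡⟨ *-identityˡ ⟦ a ⟧ ⟨
      1ℚ * ⟦ a ⟧                   ≡⟨ cong (_* ⟦ a ⟧) (recip-inverse (0<⟦⟧ k)) ⟨
      ⟦ k ⟧ * ι * ⟦ a ⟧            ≡⟨ rotate ⟦ k ⟧ ι ⟦ a ⟧ ⟩
      1ℚ * ι * (⟦ k ⟧ * ⟦ a ⟧)     ≡⟨ cong (1ℚ * ι *_) (⟦⟧-homo-* k a) ⟨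
      1ℚ * ι * ⟦ k ℕ.* a ⟧         ≤⟨ *-monoʳ (0≤* 0≤1 (<⇒≤ (0<recip (0<⟦⟧ k)))) (⟦⟧-mono ka≤d) ⟩
      1ℚ * ι * ⟦ d ⟧               ∎

  maximal⇒large : ∀ k-1 → let k = suc k-1 in
    (ε : ℝ) {{0<ε : Defs.Positive ε}} → ε Defs.< fromℕ 1 Defs./ fromℕ k →
    ∀ {n} (G : Digraph n) → let open Digraph G in
    (L : ℝ) → Defs.IsLog (fromℕ 2 Defs./ (ε Defs.* fromℕ k) Defs.- fromℕ 1) L →
    (∀ v → fromℕ 2 Defs.* (ε Defs.^ 2) Defs.⁻¹ Defs.* (fromℕ 4 Defs./ fromℕ k Defs.- ε) Defs.* L Defs.≤ fromℕ (deg⁺ v)) →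
    ∀ M → (∀ S → Sparse G k-1 S → ∣ S ∣ ℕ.≤ M) →
    (fromℕ 1 Defs./ fromℕ k Defs.- ε) Defs.* fromℕ n Defs.≤ fromℕ M
  maximal⇒large k-1 ε {{0<ε}} ε<1/k {n} G L isLog degree M maximal (mkPositive γ 0<γ Nγ gap) = <-irrefl refl (begin-strict
    γ                                       ≤⟨ gap m Nγ≤m ⟩
    (1ℚ * ι - e) * ⟦ n ⟧ - ⟦ M ⟧            ≤⟨ +-monoʳ-≤ ((1ℚ * ι - e) * ⟦ n ⟧) (neg-antimono-≤ large) ⟩
    (1ℚ * ι - e) * ⟦ n ⟧ - ⟦ n ⟧ * (ι - e - ⟦ 5 ⟧ * η)
                                            ≡⟨ cancel ι e ⟦ n ⟧ (⟦ 5 ⟧ * η) ⟩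
    ⟦ n ⟧ * (⟦ 5 ⟧ * η)                     ≤⟨ *-monoʳ (0≤⟦⟧ n) (*-monoʳ (0≤⟦⟧ 5) (p⊓q≤q ½ (γ * ρ))) ⟩
    ⟦ n ⟧ * (⟦ 5 ⟧ * (γ * ρ))               ≡⟨ regroup ⟦ n ⟧ ⟦ 5 ⟧ γ ρ ⟩
    ⟦ n ⟧ * ⟦ 5 ⟧ * ρ * γ                   <⟨ *-monoˡ-<-pos γ {{positive 0<γ}} 5nρ<1 ⟩
    1ℚ * γ                                  ≡⟨ *-identityˡ γ ⟩
    γ                                       ∎)
    where
    open ≤-Reasoning
    open Digraph G using (deg⁺)
    k = suc k-1
    ι = recip ⟦ k ⟧
    -- With `ρ = 1/(5n+1)` and `η ≤ γ ρ`, the total error `5 n η` is strictly below the assumed gap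
    -- `γ`, also when `n` is 0. The cap `½` on `η` is the one required by the tail estimate.
    ρ = recip ⟦ suc (n ℕ.* 5) ⟧
    0<ρ : 0ℚ < ρ
    0<ρ = 0<recip (0<⟦⟧ (suc (n ℕ.* 5)))
    η = ½ ⊓ (γ * ρ)
    0<η : 0ℚ < η
    0<η = 0<⊓ (positive⁻¹ ½) (0<* 0<γ 0<ρ)
    5nρ<1 : ⟦ n ⟧ * ⟦ 5 ⟧ * ρ < 1ℚ
    5nρ<1 = begin-strict
      ⟦ n ⟧ * ⟦ 5 ⟧ * ρ              ≡⟨ +-identityˡ (⟦ n ⟧ * ⟦ 5 ⟧ * ρ) ⟨
      0ℚ + ⟦ n ⟧ * ⟦ 5 ⟧ * ρ         <⟨ +-monoˡ-< (⟦ n ⟧ * ⟦ 5 ⟧ * ρ) 0<ρ ⟩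
      ρ + ⟦ n ⟧ * ⟦ 5 ⟧ * ρ          ≡⟨ cong (λ x → ρ + x * ρ) (⟦⟧-homo-* n 5) ⟨
      ρ + ⟦ n ℕ.* 5 ⟧ * ρ            ≡⟨ ⟦suc⟧* (n ℕ.* 5) ρ ⟨
      ⟦ suc (n ℕ.* 5) ⟧ * ρ          ≡⟨ recip-inverse (0<⟦⟧ (suc (n ℕ.* 5))) ⟩
      1ℚ                             ∎
    cancel : ∀ ι e n x → (1ℚ * ι - e) * n - n * (ι - e - x) ≡ n * x
    cancel = solve-∀ ring
    regroup : ∀ n f γ ρ → n * (f * (γ * ρ)) ≡ n * f * ρ * γ
    regroup = solve-∀ ring

    -- `i` is only a threshold for convergence; `suc i + suc i` lies beyond it and is even, as
    -- `exp-neg≤1` demands.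
    i = proj₁ (isLog (fromℚ η) (mkPositive η 0<η 0 (λ _ _ → ≤-refl)))
    close : fromℕ 2 Defs./ (ε Defs.* fromℕ k) Defs.- fromℕ 1 Defs.- fromℚ η Defs.< expSum L (suc i ℕ.+ suc i)
    close = proj₁ (proj₂ (isLog (fromℚ η) (mkPositive η 0<η 0 (λ _ _ → ≤-refl))) (suc i ℕ.+ suc i)
      (ℕₚ.≤-trans (ℕₚ.n≤1+n i) (ℕₚ.m≤m+n (suc i) (suc i))))

    degrees : Eventually (λ m → ∀ v →
      ⟦ 2 ⟧ * recip (seq ε m * (seq ε m * 1ℚ)) * (⟦ 4 ⟧ * ι - seq ε m) * seq L m - ⟦ deg⁺ v ⟧ ≤ η)
    degrees = every (λ v → ¬positive⇒eventually≤ (degree v) 0<η)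
    Nε = Defs.Positive.from 0<ε
    N< = Defs.Positive.from ε<1/k
    Nx = Defs.Positive.from close
    Nd = proj₁ degrees
    m = Nγ ℕ.+ Nε ℕ.+ N< ℕ.+ Nx ℕ.+ Nd
    Nγ≤m : Nγ ℕ.≤ m
    Nγ≤m = ℕₚ.≤-trans (ℕₚ.m≤m+n Nγ Nε) (ℕₚ.≤-trans (ℕₚ.m≤m+n _ N<) (ℕₚ.≤-trans (ℕₚ.m≤m+n _ Nx) (ℕₚ.m≤m+n _ Nd)))
    Nε≤m : Nε ℕ.≤ m
    Nε≤m = ℕₚ.≤-trans (ℕₚ.m≤n+m Nε Nγ) (ℕₚ.≤-trans (ℕₚ.m≤m+n _ N<) (ℕₚ.≤-trans (ℕₚ.m≤m+n _ Nx) (ℕₚ.m≤m+n _ Nd)))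
    N<≤m : N< ℕ.≤ m
    N<≤m = ℕₚ.≤-trans (ℕₚ.m≤n+m N< (Nγ ℕ.+ Nε)) (ℕₚ.≤-trans (ℕₚ.m≤m+n _ Nx) (ℕₚ.m≤m+n _ Nd))
    Nx≤m : Nx ℕ.≤ m
    Nx≤m = ℕₚ.≤-trans (ℕₚ.m≤n+m Nx (Nγ ℕ.+ Nε ℕ.+ N<)) (ℕₚ.m≤m+n _ Nd)
    Nd≤m : Nd ℕ.≤ m
    Nd≤m = ℕₚ.m≤n+m Nd (Nγ ℕ.+ Nε ℕ.+ N< ℕ.+ Nx)
    e = seq ε m
    l = seq L m
    0<e : 0ℚ < e
    0<e = <-≤-trans (Defs.Positive.0<gap 0<ε) (Defs.Positive.above 0<ε m Nε≤m)
    e≤ι : e ≤ ι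
    e≤ι = 0≤q-p⇒p≤q (subst (λ x → 0ℚ ≤ x - e) (*-identityˡ ι)
      (≤-trans (<⇒≤ (Defs.Positive.0<gap ε<1/k)) (Defs.Positive.above ε<1/k m N<≤m)))
    x-η≤exp : (⟦ 2 ⟧ * recip (e * ⟦ k ⟧) - 1ℚ) - η ≤ exp< (suc i ℕ.+ suc i) l
    x-η≤exp = 0≤q-p⇒p≤q (≤-trans (<⇒≤ (Defs.Positive.0<gap close)) (≤-trans (Defs.Positive.above close m Nx≤m)
      (≤-reflexive (cong (_- ((⟦ 2 ⟧ * recip (e * ⟦ k ⟧) - 1ℚ) - η)) (seq-expSum L (suc i ℕ.+ suc i) m)))))
    cancelʳ : ∀ {a b c} → a - b ≤ c → a ≤ b + c
    cancelʳ {a} {b} {c} a-b≤c = subst (_≤ b + c) (restore a b) (+-monoʳ-≤ b a-b≤c)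
      where
      restore : ∀ a b → b + (a - b) ≡ a
      restore = solve-∀ ring
    large : ⟦ n ⟧ * (ι - e - ⟦ 5 ⟧ * η) ≤ ⟦ M ⟧
    large = sparse-bound G k-1 0<e e≤ι (<⇒≤ 0<η) (p⊓q≤p ½ (γ * ρ)) i x-η≤exp
      (λ v → cancelʳ (proj₂ degrees m Nd≤m v)) M maximal

open import Defs
open import Data.Nat.Base using (ℕ; suc; NonZero) renaming (_≤_ to _≤ℕ_)
open import Data.Fin.Base using (Fin)
open import Data.Fin.Subset using (Subset; ∣_∣; _∈_; _∩_)
open import Data.Fin.Subset.Properties using (∉⊥)
open import Data.Product.Base using (∃-syntax; _×_; _,_)
open import Relation.Nullary using (contradiction)
open Proof using (maximum-subset; sparse?; maximal⇒large; sparse⇒≤)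

proposition10 : (k : ℕ) .{{_ : NonZero k}} → 2 ≤ℕ k →
    (ε : ℝ) {{0<ε : Positive ε}} → ε < fromℕ 1 / fromℕ k →
    (n : ℕ) (G : Digraph n) → let open Digraph G in
    (L : ℝ) → IsLog (fromℕ 2 / (ε * fromℕ k) - fromℕ 1) L →
    ((v : Fin n) → fromℕ 2 * (ε ^ 2) ⁻¹ * (fromℕ 4 / fromℕ k - ε) * L ≤ fromℕ (deg⁺ v)) →
    ∃[ T ] ((fromℕ 1 / fromℕ k - ε) * fromℕ n ≤ fromℕ ∣ T ∣
    × ((v : Fin n) → v ∈ T → fromℕ ∣ N⁺ v ∩ T ∣ ≤ fromℕ 1 / fromℕ k * fromℕ (deg⁺ v)))
proposition10 (suc k-1) _ ε ε<1/k n G L isLog degree =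
  -- The search involves only `G` and `k`, never the reals, so the witness is computed outright; the
  -- empty set is vacuously sparse.
  let (T , sparse , maximal) = maximum-subset (sparse? G k-1) (λ _ v∈⊥ → contradiction v∈⊥ ∉⊥)
  in T , maximal⇒large k-1 ε ε<1/k G L isLog degree ∣ T ∣ maximal
       , λ v v∈T → sparse⇒≤ (suc k-1) (sparse v v∈T)
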